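{- Let $\lambda$ be a partition of a positive integer $n$, let $k=\lambda_1$, and let $a_1>a_2>\dots>a_k$ be the hook lengths of the cells in the first row of $\lambda$. Then for every non-negative integer $m$, \[ E_m(\lambda)=\sum_{i=0}^{m}\binom{k-i}{m-i}S_{m-i}(m-k-1)\,\sigma_i(a_1,\dots,a_k), \] where $\sigma_i(a_1,\dots,a_k)=\sum_{1\le\iota_1<\dots<\iota_i\le k}a_{\iota_1}\cdots a_{\iota_i}$ is the $i$-th elementary symmetric polynomial ($\sigma_0=1$, and $\sigma_i=0$ for $i>k$).
   Context: Cell $(i,j)$ lies in $\lambda$ iff $j\le\lambda_i$; $h_{i,j}$ is its hook length. For the one-row partition $[m]\le\lambda$, place pebbles on cells $(1,1),\dots,(1,m)$. A local excitation move moves a pebble from $(i,j)$ to $(i+1,j+1)$ provided $(i,j+1)$, $(i+1,j)$, $(i+1,j+1)$ are unoccupied and $(i+1,j+1)$ lies in $\lambda$. Excited diagrams are the sets of occupied cells after any finite sequence of such moves, and $E_m(\lambda)=\sum_{\varepsilon}\prod_{(i,j)\in\varepsilon}h_{i,j}$ over all excited diagrams $\varepsilon$ of $[m]$ in $\lambda$; $E_0(\lambda)=1$ and $E_m(\lambda)=0$ if $m>\lambda_1$. The Stirling polynomials $S_j(x)\in\mathbb{Q}[x]$ ($j\ge0$) are defined by requiring $\binom{\ell}{j}S_j(\ell)=\sigma_j(\ell,\ell-1,\dots,1)$ for every positive integer $\ell$. Binomial coefficients $\binom{x}{j}=x(x-1)\cdots(x-j+1)/j!$ are taken as polynomials in $x$,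 so they are defined for all integers $x$. -}

module Defs where

import Data.Nat as N
open import Data.Nat.ListAction using () renaming (sum to sumℕ)
open import Data.Nat using (ℕ; zero; suc; _≤_; _<_; _∸_; _≤?_)
open import Data.Nat.Properties using ()
open import Data.Integer as ℤ using (ℤ)
open import Data.Rational using (ℚ; 0ℚ; 1ℚ; _/_; _+_; _*_; _-_)
open import Data.Product using (Σ; _×_; _,_)
open import Data.List as List using (List; []; _∷_; _++_; map; filter; length; upTo; downFrom)
open import Data.List.Relation.Unary.All as LAll using ()
open import Data.List.Relation.Unary.Any as LAny using ()
open import Data.List.Relation.Unary.AllPairs using (AllPairs)
open import Data.List.Relation.Unary.Linked using (Linked)
open import Data.Vec as Vec using (Vec; tabulate; lookup; _[_]≔_)
open import Data.Vec.Membership.Propositional using (_∈_)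
open import Data.Fin using (Fin; toℕ)
open import Relation.Nullary using (¬_)
open import Relation.Binary.PropositionalEquality using (_≡_)
open import Relation.Binary.Construct.Closure.ReflexiveTransitive using (Star)

ℕtoℚ : ℕ → ℚ
ℕtoℚ n = ℤ.+ n / 1

sumℚ : List ℚ → ℚ
sumℚ = List.foldr _+_ 0ℚ

prodℚ : List ℚ → ℚ
prodℚ = List.foldr _*_ 1ℚ

-- Polynomials over ℚ as coefficient lists (constant term first).
Poly : Set
Poly = List ℚ

eval : Poly → ℚ → ℚ
eval []       x = 0ℚ
eval (c ∷ cs) x = c + x * eval cs x

binomQ : ℚ → ℕ → ℚ
binomQ x zero    = 1ℚ
binomQ x (suc j) = binomQ x j * ((x - ℕtoℚ j) * (ℤ.+ 1 / suc j))

choose : {A : Set} → ℕ → List A → List (List A)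
choose zero    xs       = [] ∷ []
choose (suc i) []       = []
choose (suc i) (x ∷ xs) = map (x ∷_) (choose i xs) ++ choose (suc i) xs

esym : List ℚ → ℕ → ℚ
esym xs i = sumℚ (map prodℚ (choose i xs))

Partition : Set
Partition = List ℕ

IsPartitionOf : ℕ → Partition → Set
IsPartitionOf n λ′ = LAll.All (1 ≤_) λ′ × Linked N._≥_ λ′ × sumℕ λ′ ≡ n

row : Partition → ℕ → ℕ
row λ′ zero          = 0
row []   (suc i)     = 0
row (x ∷ xs) (suc zero)    = x
row (x ∷ xs) (suc (suc i)) = row xs (suc i)

col : Partition → ℕ → ℕ
col λ′ j = length (filter (j ≤?_) λ′)

Cell : Set
Cell = ℕ × ℕ

InDiagram : Partition → Cell → Set
InDiagram λ′ (i , j) = 1 ≤ i × 1 ≤ j × j ≤ row λ′ i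

hook : Partition → Cell → ℕ
hook λ′ (i , j) = (row λ′ i ∸ j) N.+ (col λ′ j ∸ i) N.+ 1

-- Excited diagrams of the one-row partition [m]

-- A configuration: position of each of the m pebbles.
Config : ℕ → Set
Config m = Vec Cell m

initial : (m : ℕ) → Config m
initial m = tabulate (λ p → (1 , suc (toℕ p)))

Step : Partition → {m : ℕ} → Config m → Config m → Set
Step λ′ {m} v w = Σ (Fin m) λ p → Move (lookup v p) p
  where
  Move : Cell → Fin m → Set
  Move (i , j) p =
    ¬ ((i , suc j) ∈ v) × ¬ ((suc i , j) ∈ v) × ¬ ((suc i , suc j) ∈ v)
    × InDiagram λ′ (suc i , suc j) × w ≡ (v [ p ]≔ (suc i , suc j))

Reachable : Partition → (m : ℕ) → Config m → Set
Reachable λ′ m v = Star (Step λ′) (initial m) v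

SameSet : {m : ℕ} → Config m → Config m → Set
SameSet v w = ∀ c → (c ∈ v → c ∈ w) × (c ∈ w → c ∈ v)

Enumerates : Partition → (m : ℕ) → List (Config m) → Set
Enumerates λ′ m L =
  LAll.All (Reachable λ′ m) L
  × (∀ v → Reachable λ′ m v → LAny.Any (SameSet v) L)
  × AllPairs (λ v w → ¬ SameSet v w) L

weight : Partition → {m : ℕ} → Config m → ℕ
weight λ′ v = Vec.foldr _ N._*_ 1 (Vec.map (hook λ′) v)

EIs : Partition → ℕ → ℚ → Set
EIs λ′ m e =
  (m ≤ row λ′ 1 →
     Σ (List (Config m)) (Enumerates λ′ m)
     × (∀ L → Enumerates λ′ m L → sumℚ (map (λ v → ℕtoℚ (weight λ′ v)) L) ≡ e))
  × (row λ′ 1 < m → e ≡ 0ℚ)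

firstRowHooks : Partition → List ℚ
firstRowHooks λ′ = map (λ j → ℕtoℚ (hook λ′ (1 , suc j))) (upTo (row λ′ 1))

IsStirling : (ℕ → Poly) → Set
IsStirling S = ∀ j ℓ → 1 ≤ ℓ →
  binomQ (ℕtoℚ ℓ) j * eval (S j) (ℕtoℚ ℓ) ≡ esym (map ℕtoℚ (map suc (downFrom ℓ))) j

rhs : (ℕ → Poly) → Partition → ℕ → ℚ
rhs S λ′ m = sumℚ (map term (upTo (suc m)))
  where
  k = row λ′ 1
  term : ℕ → ℚ
  term i = binomQ (ℕtoℚ k - ℕtoℚ i) (m ∸ i)
           * eval (S (m ∸ i)) (ℕtoℚ m - ℕtoℚ k - 1ℚ)
           * esym (firstRowHooks λ′) i

{-# OPTIONS --safe #-}

-- The pebbles of an excited diagram stay in order, so diagrams correspond to weakly increasing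
-- sequences of displacements. Whether the leftmost pebble, at (i, j), ever moves gives
--   E(i, j, m) = h(i, j) E(i, j + 1, m - 1) + E(i + 1, j + 1, m)
-- for the hook-weighted sum over m pebbles starting at (i, j).
-- Number the steps of the boundary path of λ from the end of the first row; then h(i, j) is the
-- difference γ_j - ρ_i of the numbers of the steps in column j and row i, and γ_j = a_j. The same
-- recursion holds for
--   F = [s^m] ∏_{j ≤ c ≤ λ_i} (1 + γ_c s) / ∏_{0 ≤ r ≤ λ_i - j + 1 - m} (1 + (ρ_i + r) s),
-- since the columns which end in row i cancel against denominators when passing to row i + 1.
-- For i = j = 1 this reads E_m(λ) = Σ_i (-1)^{m-i} h_{m-i}(1, …, k - m) σ_i(a). Finally the recursion
-- of σ_j(x, x - 1, …, 1) in x is a polynomial identity, and at negative x it becomes the recursion of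
-- the complete symmetric polynomials h_j(1, …, n).

module Submission where

open import Defs
open import Data.Fin using (Fin; zero; suc; toℕ)
import Data.Integer as ℤ
import Data.Integer.Properties as ℤ
open import Data.List using (List; []; _∷_; _++_; map; upTo; applyUpTo; downFrom; length)
open import Data.List.Membership.Propositional using (find) renaming (_∈_ to _∈ₗ_)
open import Data.List.Membership.Propositional.Properties using (∈-++⁻; ∈-++⁺ˡ; ∈-++⁺ʳ; ∈-map⁺; ∈-map⁻)
open import Data.List.Membership.Propositional.Properties.WithK using (unique∧set⇒bag)
open import Data.List.Properties using (map-++; map-∘; upTo-∷ʳ; length-map; length-applyUpTo; filter-accept; filter-reject)
open import Data.List.Relation.Binary.BagAndSetEquality using (∼bag⇒↭)
open import Data.List.Relation.Binary.Permutation.Propositional using (_↭_; ↭⇒↭ₛ)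
open import Data.List.Relation.Binary.Permutation.Propositional.Properties using (map⁺)
import Data.List.Relation.Binary.Permutation.Setoid.Properties as ↭ₛ
open import Data.List.Relation.Unary.All as LAll using (All; []; _∷_)
open import Data.List.Relation.Unary.AllPairs as AllPairs using (AllPairs; []; _∷_)
open import Data.List.Relation.Unary.Any as LAny using ()
open import Data.List.Relation.Unary.Linked as Linked using (Linked; [-]; _∷_)
open import Data.List.Relation.Unary.Unique.Propositional using (Unique)
import Data.List.Relation.Unary.Unique.Propositional.Properties as Unique
open import Data.Nat as ℕ using (ℕ; zero; suc; _≤_; _<_; _∸_; z≤n; s≤s; _≤?_)
import Data.Nat.Coprimality as Coprime
import Data.Nat.Properties as ℕ
import Data.Nat.Tactic.RingSolver as ℕRing
open import Data.Product using (Σ; _×_; _,_; proj₁; proj₂)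
open import Data.Rational using (ℚ; mkℚ; 0ℚ; 1ℚ; _/_; _+_; _*_; _-_; -_; 1/_; ≢-nonZero)
open import Data.Rational.Properties as ℚₚ using (+-*-commutativeRing)
open import Data.Sum using (inj₁; inj₂)
open import Data.Unit using (⊤; tt)
open import Data.Vec using ([]; _∷_; lookup; _[_]≔_; tabulate)
open import Data.Vec.Membership.Propositional using (_∈_)
open import Data.Vec.Membership.Propositional.Properties using (∈-lookup)
open import Data.Vec.Properties using (tabulate-cong)
open import Data.Vec.Relation.Unary.Any using (here; there)
open import Function using (_∘_; id; mk⇔)
open import Relation.Binary.Construct.Closure.ReflexiveTransitive using (Star; ε; _◅_; _◅◅_)
open import Relation.Binary.PropositionalEquality
open import Relation.Nullary using (¬_; contradiction; yes; no)
open import Relation.Nullary.Decidable using (dec⇒maybe)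
open import Tactic.RingSolver using (solve-∀)
open import Tactic.RingSolver.Core.AlmostCommutativeRing using (AlmostCommutativeRing; fromCommutativeRing)
open ≡-Reasoning

-- Rational arithmetic and the embedding of the naturals.

ℚring : AlmostCommutativeRing _ _
ℚring = fromCommutativeRing +-*-commutativeRing (λ x → dec⇒maybe (0ℚ ℚₚ.≟ x))

ℕtoℚ-mkℚ : ∀ n → ℕtoℚ n ≡ mkℚ (ℤ.+ n) 0 (Coprime.sym (Coprime.1-coprimeTo n))
ℕtoℚ-mkℚ n = ℚₚ.normalize-coprime (Coprime.sym (Coprime.1-coprimeTo n))

ℕtoℚ-+ : ∀ a b → ℕtoℚ (a ℕ.+ b) ≡ ℕtoℚ a + ℕtoℚ b
ℕtoℚ-+ a b rewrite ℕtoℚ-mkℚ a | ℕtoℚ-mkℚ b =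
  cong (_/ 1) (sym (cong₂ ℤ._+_ (ℤ.*-identityʳ (ℤ.+ a)) (ℤ.*-identityʳ (ℤ.+ b))))

ℕtoℚ-* : ∀ a b → ℕtoℚ (a ℕ.* b) ≡ ℕtoℚ a * ℕtoℚ b
ℕtoℚ-* a b rewrite ℕtoℚ-mkℚ a | ℕtoℚ-mkℚ b = cong (_/ 1) (ℤ.pos-* a b)

ℕtoℚ-suc : ∀ n → ℕtoℚ (suc n) ≡ ℕtoℚ n + 1ℚ
ℕtoℚ-suc n = trans (cong ℕtoℚ (ℕ.+-comm 1 n)) (ℕtoℚ-+ n 1)

ℕtoℚ-injective : ∀ {a b} → ℕtoℚ a ≡ ℕtoℚ b → a ≡ b
ℕtoℚ-injective {a} {b} eq =
  ℤ.+-injective (cong ℚ.numerator (trans (sym (ℕtoℚ-mkℚ a)) (trans eq (ℕtoℚ-mkℚ b))))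

ℕtoℚ-∸ : ∀ {a b} → a ≤ b → ℕtoℚ (b ∸ a) ≡ ℕtoℚ b - ℕtoℚ a
ℕtoℚ-∸ {a} {b} a≤b = begin
  ℕtoℚ (b ∸ a)                     ≡⟨ lemma _ _ ⟩
  (ℕtoℚ (b ∸ a) + ℕtoℚ a) - ℕtoℚ a ≡⟨ cong (_- ℕtoℚ a) (ℕtoℚ-+ (b ∸ a) a) ⟨
  ℕtoℚ (b ∸ a ℕ.+ a) - ℕtoℚ a      ≡⟨ cong (λ c → ℕtoℚ c - ℕtoℚ a) (ℕ.m∸n+n≡m a≤b) ⟩
  ℕtoℚ b - ℕtoℚ a                  ∎
  where
  lemma : ∀ x y → x ≡ (x + y) - y
  lemma = solve-∀ ℚring

p*q≡0⇒q≡0 : ∀ {p q} → p ≢ 0ℚ → p * q ≡ 0ℚ → q ≡ 0ℚ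
p*q≡0⇒q≡0 {p} {q} p≢0 pq≡0 = begin
  q               ≡⟨ ℚₚ.*-identityˡ q ⟨
  1ℚ * q          ≡⟨ cong (_* q) (ℚₚ.*-inverseˡ p) ⟨
  (1/ p * p) * q  ≡⟨ ℚₚ.*-assoc (1/ p) p q ⟩
  1/ p * (p * q)  ≡⟨ cong (1/ p *_) pq≡0 ⟩
  1/ p * 0ℚ       ≡⟨ ℚₚ.*-zeroʳ (1/ p) ⟩
  0ℚ              ∎
  where instance _ = ≢-nonZero p≢0

x-y≡0⇒x≡y : ∀ {x y} → x - y ≡ 0ℚ → x ≡ y
x-y≡0⇒x≡y {x} {y} eq = begin
  x           ≡⟨ lemma x y ⟩
  (x - y) + y ≡⟨ cong (_+ y) eq ⟩
  0ℚ + y      ≡⟨ ℚₚ.+-identityˡ y ⟩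
  y           ∎
  where
  lemma : ∀ x y → x ≡ (x - y) + y
  lemma = solve-∀ ℚring

-- Polynomial functions

-- The quotient of c + x q(x) by x - a does not depend on c.
quotient : ℚ → Poly → Poly
quotient a []      = []
quotient a (c ∷ q) = eval (c ∷ q) a ∷ quotient a q

quotient-length : ∀ a q → length (quotient a q) ≡ length q
quotient-length a []      = refl
quotient-length a (c ∷ q) = cong suc (quotient-length a q)

-- Horner's scheme: the values at `a` of the proper tails of the coefficient list are the
-- coefficients of the quotient.
factor : ∀ c q a x → eval (c ∷ q) x ≡ eval (c ∷ q) a + (x - a) * eval (quotient a q) x
factor c []      a x = lemma c a x
  where
  lemma : ∀ c a x → c + x * 0ℚ ≡ (c + a * 0ℚ) + (x - a) * 0ℚ
  lemma = solve-∀ ℚring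
factor c (d ∷ q) a x = begin
  c + x * eval (d ∷ q) x ≡⟨ cong (λ y → c + x * y) (factor d q a x) ⟩
  c + x * (p + (x - a) * r) ≡⟨ lemma c a x p r ⟩
  (c + a * p) + (x - a) * (p + x * r) ∎
  where
  p = eval (d ∷ q) a
  r = eval (quotient a q) x
  lemma : ∀ c a x p r → c + x * (p + (x - a) * r) ≡ (c + a * p) + (x - a) * (p + x * r)
  lemma = solve-∀ ℚring

-- The root N is split off. For n > N the factor n - N is invertible, so the quotient, one
-- coefficient shorter, vanishes from N + 1 on. The recursion is on the length because the quotient
-- is not a subterm of the polynomial.
eval≡0 : ∀ d p → length p ≡ d → ∀ N → (∀ n → N ≤ n → eval p (ℕtoℚ n) ≡ 0ℚ) → ∀ x → eval p x ≡ 0ℚ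
eval≡0 zero    []      _   N h x = refl
eval≡0 (suc d) (c ∷ q) len N h x = begin
  eval (c ∷ q) x                                     ≡⟨ factor c q a x ⟩
  eval (c ∷ q) a + (x - a) * eval (quotient a q) x ≡⟨ cong₂ (λ y z → y + (x - a) * z) (h N ℕ.≤-refl) quotient≡0 ⟩
  0ℚ + (x - a) * 0ℚ                                ≡⟨ ℚₚ.+-identityˡ _ ⟩
  (x - a) * 0ℚ                                     ≡⟨ ℚₚ.*-zeroʳ (x - a) ⟩
  0ℚ                                               ∎
  where
  a = ℕtoℚ N
  root : ∀ n → N < n → eval (quotient a q) (ℕtoℚ n) ≡ 0ℚ
  root n N<n = p*q≡0⇒q≡0 (λ eq → ℕ.<⇒≢ N<n (sym (ℕtoℚ-injective (x-y≡0⇒x≡y eq)))) (begin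
    (ℕtoℚ n - a) * e                  ≡⟨ ℚₚ.+-identityˡ _ ⟨
    0ℚ + (ℕtoℚ n - a) * e             ≡⟨ cong (_+ (ℕtoℚ n - a) * e) (h N ℕ.≤-refl) ⟨
    eval (c ∷ q) a + (ℕtoℚ n - a) * e ≡⟨ factor c q a (ℕtoℚ n) ⟨
    eval (c ∷ q) (ℕtoℚ n)             ≡⟨ h n (ℕ.<⇒≤ N<n) ⟩
    0ℚ                                ∎)
    where e = eval (quotient a q) (ℕtoℚ n)
  quotient≡0 : eval (quotient a q) x ≡ 0ℚ
  quotient≡0 = eval≡0 d (quotient a q) (trans (quotient-length a q) (ℕ.suc-injective len)) (suc N) root x

-- Only values matter below, so a function comes with a representing coefficient list and such lists
-- are never compared.
IsPolynomial : (ℚ → ℚ) → Set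
IsPolynomial f = Σ Poly λ p → ∀ x → eval p x ≡ f x

infixl 6 _+ₚ_
_+ₚ_ : Poly → Poly → Poly
[]      +ₚ q       = q
(c ∷ p) +ₚ []      = c ∷ p
(c ∷ p) +ₚ (d ∷ q) = (c + d) ∷ (p +ₚ q)

eval-+ₚ : ∀ p q x → eval (p +ₚ q) x ≡ eval p x + eval q x
eval-+ₚ []      q       x = sym (ℚₚ.+-identityˡ _)
eval-+ₚ (c ∷ p) []      x = sym (ℚₚ.+-identityʳ _)
eval-+ₚ (c ∷ p) (d ∷ q) x =
  trans (cong (λ y → (c + d) + x * y) (eval-+ₚ p q x)) (lemma c d x (eval p x) (eval q x))
  where
  lemma : ∀ c d x p q → (c + d) + x * (p + q) ≡ (c + x * p) + (d + x * q)
  lemma = solve-∀ ℚring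

scale : ℚ → Poly → Poly
scale a = map (a *_)

eval-scale : ∀ a p x → eval (scale a p) x ≡ a * eval p x
eval-scale a []      x = sym (ℚₚ.*-zeroʳ a)
eval-scale a (c ∷ p) x = trans (cong (λ y → a * c + x * y) (eval-scale a p x)) (lemma a c x (eval p x))
  where
  lemma : ∀ a c x p → a * c + x * (a * p) ≡ a * (c + x * p)
  lemma = solve-∀ ℚring

infixl 7 _*ₚ_
_*ₚ_ : Poly → Poly → Poly
[]      *ₚ q = []
(c ∷ p) *ₚ q = scale c q +ₚ (0ℚ ∷ p *ₚ q)

eval-*ₚ : ∀ p q x → eval (p *ₚ q) x ≡ eval p x * eval q x
eval-*ₚ []      q x = sym (ℚₚ.*-zeroˡ (eval q x))
eval-*ₚ (c ∷ p) q x = begin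
  eval (scale c q +ₚ (0ℚ ∷ p *ₚ q)) x              ≡⟨ eval-+ₚ (scale c q) (0ℚ ∷ p *ₚ q) x ⟩
  eval (scale c q) x + (0ℚ + x * eval (p *ₚ q) x)  ≡⟨ cong₂ (λ y z → y + (0ℚ + x * z)) (eval-scale c q x) (eval-*ₚ p q x) ⟩
  c * eval q x + (0ℚ + x * (eval p x * eval q x))  ≡⟨ lemma c x (eval p x) (eval q x) ⟩
  (c + x * eval p x) * eval q x                    ∎
  where
  lemma : ∀ c x p q → c * q + (0ℚ + x * (p * q)) ≡ (c + x * p) * q
  lemma = solve-∀ ℚring

const-polynomial : ∀ a → IsPolynomial (λ _ → a)
const-polynomial a = a ∷ [] , λ x → trans (cong (a +_) (ℚₚ.*-zeroʳ x)) (ℚₚ.+-identityʳ a)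

id-polynomial : IsPolynomial (λ x → x)
id-polynomial = 0ℚ ∷ 1ℚ ∷ [] , lemma
  where
  lemma : ∀ x → 0ℚ + x * (1ℚ + x * 0ℚ) ≡ x
  lemma = solve-∀ ℚring

+-polynomial : ∀ {f g} → IsPolynomial f → IsPolynomial g → IsPolynomial (λ x → f x + g x)
+-polynomial (p , p≗f) (q , q≗g) = p +ₚ q , λ x → trans (eval-+ₚ p q x) (cong₂ _+_ (p≗f x) (q≗g x))

*-polynomial : ∀ {f g} → IsPolynomial f → IsPolynomial g → IsPolynomial (λ x → f x * g x)
*-polynomial (p , p≗f) (q , q≗g) = p *ₚ q , λ x → trans (eval-*ₚ p q x) (cong₂ _*_ (p≗f x) (q≗g x))

∘-polynomial : ∀ {f g} → IsPolynomial f → IsPolynomial g → IsPolynomial (λ x → f (g x))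
∘-polynomial {f} {g} (p , p≗f) gp = proj₁ (go p) , λ x → trans (proj₂ (go p) x) (p≗f (g x))
  where
  go : ∀ p → IsPolynomial (λ x → eval p (g x))
  go []      = const-polynomial 0ℚ
  go (c ∷ p) = +-polynomial (const-polynomial c) (*-polynomial gp (go p))

difference-polynomial : ∀ {f g} → IsPolynomial f → IsPolynomial g → IsPolynomial (λ x → f x - g x)
difference-polynomial {f} {g} fp gp = proj₁ sum , λ x → trans (proj₂ sum x) (lemma (f x) (g x))
  where
  sum : IsPolynomial (λ x → f x + (- 1ℚ) * g x)
  sum = +-polynomial fp (*-polynomial (const-polynomial (- 1ℚ)) gp)
  lemma : ∀ x y → x + (- 1ℚ) * y ≡ x - y
  lemma = solve-∀ ℚring

-- The difference has infinitely many roots. This carries identities known at large integers over to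
-- the negative arguments at which the theorem evaluates the Stirling polynomials.
polynomial-ext : ∀ {f g} → IsPolynomial f → IsPolynomial g →
  ∀ N → (∀ n → N ≤ n → f (ℕtoℚ n) ≡ g (ℕtoℚ n)) → ∀ x → f x ≡ g x
polynomial-ext {f} {g} fp gp N f≡g x =
  x-y≡0⇒x≡y (trans (sym (proj₂ diff x)) (eval≡0 (length (proj₁ diff)) (proj₁ diff) refl N root x))
  where
  diff : IsPolynomial (λ x → f x - g x)
  diff = difference-polynomial fp gp
  root : ∀ n → N ≤ n → eval (proj₁ diff) (ℕtoℚ n) ≡ 0ℚ
  root n N≤n = begin
    eval (proj₁ diff) (ℕtoℚ n)  ≡⟨ proj₂ diff (ℕtoℚ n) ⟩
    f (ℕtoℚ n) - g (ℕtoℚ n)     ≡⟨ cong (_- g (ℕtoℚ n)) (f≡g n N≤n) ⟩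
    g (ℕtoℚ n) - g (ℕtoℚ n)     ≡⟨ ℚₚ.+-inverseʳ (g (ℕtoℚ n)) ⟩
    0ℚ                          ∎

-- Binomial coefficients

binomQ-polynomial : ∀ j → IsPolynomial (λ x → binomQ x j)
binomQ-polynomial zero    = const-polynomial 1ℚ
binomQ-polynomial (suc j) = *-polynomial (binomQ-polynomial j)
  (*-polynomial (difference-polynomial id-polynomial (const-polynomial (ℕtoℚ j))) (const-polynomial (ℤ.+ 1 / suc j)))

-- The definition splits off the last factor of the falling product; upper negation needs the first
-- one instead.
binomQ-absorption : ∀ x j → binomQ (x + 1ℚ) (suc j) ≡ binomQ x j * ((x + 1ℚ) * (ℤ.+ 1 / suc j))
binomQ-absorption x zero    = lemma x (ℤ.+ 1 / 1)
  where
  lemma : ∀ x y → 1ℚ * (((x + 1ℚ) - 0ℚ) * y) ≡ 1ℚ * ((x + 1ℚ) * y)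
  lemma = solve-∀ ℚring
binomQ-absorption x (suc j) = begin
  binomQ (x + 1ℚ) (suc j) * (((x + 1ℚ) - ℕtoℚ (suc j)) * r)  ≡⟨ cong₂ (λ y z → y * (((x + 1ℚ) - z) * r)) (binomQ-absorption x j) (ℕtoℚ-suc j) ⟩
  (b * ((x + 1ℚ) * s)) * (((x + 1ℚ) - (ℕtoℚ j + 1ℚ)) * r)    ≡⟨ lemma b x s (ℕtoℚ j) r ⟩
  (b * ((x - ℕtoℚ j) * s)) * ((x + 1ℚ) * r)                  ∎
  where
  b = binomQ x j
  s = ℤ.+ 1 / suc j
  r = ℤ.+ 1 / suc (suc j)
  lemma : ∀ b x s j r → (b * ((x + 1ℚ) * s)) * (((x + 1ℚ) - (j + 1ℚ)) * r) ≡ (b * ((x - j) * s)) * ((x + 1ℚ) * r)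
  lemma = solve-∀ ℚring

binomQ≡0 : ∀ n j → n < j → binomQ (ℕtoℚ n) j ≡ 0ℚ
binomQ≡0 n (suc j) (s≤s n≤j) with ℕ.m≤n⇒m<n∨m≡n n≤j
... | inj₁ n<j  = trans (cong (_* ((ℕtoℚ n - ℕtoℚ j) * (ℤ.+ 1 / suc j))) (binomQ≡0 n j n<j)) (ℚₚ.*-zeroˡ ((ℕtoℚ n - ℕtoℚ j) * (ℤ.+ 1 / suc j)))
... | inj₂ refl = lemma (binomQ (ℕtoℚ n) j) (ℕtoℚ n) (ℤ.+ 1 / suc j)
  where
  lemma : ∀ b x r → b * ((x - x) * r) ≡ 0ℚ
  lemma = solve-∀ ℚring

sign : ℕ → ℚ
sign zero    = 1ℚ
sign (suc j) = - sign j

-- Upper negation: the factors y + 1, ..., y + j are the negatives of those on the right.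
binomQ-negation : ∀ y j → binomQ (y + ℕtoℚ j) j ≡ sign j * binomQ (- y - 1ℚ) j
binomQ-negation y zero    = refl
binomQ-negation y (suc j) = begin
  binomQ (y + ℕtoℚ (suc j)) (suc j)                      ≡⟨ cong (λ z → binomQ z (suc j)) (trans (cong (y +_) (ℕtoℚ-suc j)) (sym (ℚₚ.+-assoc y (ℕtoℚ j) 1ℚ))) ⟩
  binomQ ((y + ℕtoℚ j) + 1ℚ) (suc j)                     ≡⟨ binomQ-absorption (y + ℕtoℚ j) j ⟩
  binomQ (y + ℕtoℚ j) j * (((y + ℕtoℚ j) + 1ℚ) * r)      ≡⟨ cong (_* (((y + ℕtoℚ j) + 1ℚ) * r)) (binomQ-negation y j) ⟩
  (sign j * b) * (((y + ℕtoℚ j) + 1ℚ) * r)               ≡⟨ lemma (sign j) b y (ℕtoℚ j) r ⟩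
  (- sign j) * (b * (((- y - 1ℚ) - ℕtoℚ j) * r))         ∎
  where
  b = binomQ (- y - 1ℚ) j
  r = ℤ.+ 1 / suc j
  lemma : ∀ s b y j r → (s * b) * (((y + j) + 1ℚ) * r) ≡ (- s) * (b * (((- y - 1ℚ) - j) * r))
  lemma = solve-∀ ℚring

-- Finite sums and elementary symmetric polynomials.

sumℚ-++ : ∀ xs ys → sumℚ (xs ++ ys) ≡ sumℚ xs + sumℚ ys
sumℚ-++ []       ys = sym (ℚₚ.+-identityˡ _)
sumℚ-++ (x ∷ xs) ys = trans (cong (x +_) (sumℚ-++ xs ys)) (sym (ℚₚ.+-assoc x _ _))

sumℚ-*ˡ : ∀ {A : Set} a (f : A → ℚ) xs → sumℚ (map (λ x → a * f x) xs) ≡ a * sumℚ (map f xs)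
sumℚ-*ˡ a f []       = sym (ℚₚ.*-zeroʳ a)
sumℚ-*ˡ a f (x ∷ xs) = trans (cong (a * f x +_) (sumℚ-*ˡ a f xs)) (sym (ℚₚ.*-distribˡ-+ a _ _))

esym-∷ : ∀ x xs i → esym (x ∷ xs) (suc i) ≡ esym xs (suc i) + x * esym xs i
esym-∷ x xs i = begin
  sumℚ (map prodℚ (map (x ∷_) (choose i xs) ++ choose (suc i) xs))
    ≡⟨ cong sumℚ (map-++ prodℚ (map (x ∷_) (choose i xs)) _) ⟩
  sumℚ (map prodℚ (map (x ∷_) (choose i xs)) ++ map prodℚ (choose (suc i) xs))
    ≡⟨ sumℚ-++ (map prodℚ (map (x ∷_) (choose i xs))) _ ⟩
  sumℚ (map prodℚ (map (x ∷_) (choose i xs))) + esym xs (suc i)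
    ≡⟨ cong (λ y → sumℚ y + esym xs (suc i)) (map-∘ (choose i xs)) ⟨
  sumℚ (map (λ ys → x * prodℚ ys) (choose i xs)) + esym xs (suc i)
    ≡⟨ cong (_+ esym xs (suc i)) (sumℚ-*ˡ x prodℚ (choose i xs)) ⟩
  x * esym xs i + esym xs (suc i)
    ≡⟨ ℚₚ.+-comm (x * esym xs i) _ ⟩
  esym xs (suc i) + x * esym xs i ∎

esym-zero : ∀ xs → esym xs 0 ≡ 1ℚ
esym-zero []       = refl
esym-zero (x ∷ xs) = refl

esym≡0 : ∀ xs i → length xs < i → esym xs i ≡ 0ℚ
esym≡0 []       (suc i) _        = refl
esym≡0 (x ∷ xs) (suc i) (s≤s lt) = begin
  esym (x ∷ xs) (suc i)           ≡⟨ esym-∷ x xs i ⟩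
  esym xs (suc i) + x * esym xs i ≡⟨ cong₂ (λ y z → y + x * z) (esym≡0 xs (suc i) (ℕ.m≤n⇒m≤1+n lt)) (esym≡0 xs i lt) ⟩
  0ℚ + x * 0ℚ                     ≡⟨ trans (ℚₚ.+-identityˡ _) (ℚₚ.*-zeroʳ x) ⟩
  0ℚ                              ∎

-- Formal power series

Series : Set
Series = ℕ → ℚ

one : Series
one zero    = 1ℚ
one (suc _) = 0ℚ

-- Multiplication by 1 + a s and by its inverse.
mul : ℚ → Series → Series
mul a f zero    = f zero
mul a f (suc n) = f (suc n) + a * f n

div : ℚ → Series → Series
div t f zero    = f zero
div t f (suc n) = f (suc n) - t * div t f n

mul-cong : ∀ a {f g} → f ≗ g → mul a f ≗ mul a g
mul-cong a f≗g zero    = f≗g zero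
mul-cong a f≗g (suc n) = cong₂ (λ x y → x + a * y) (f≗g (suc n)) (f≗g n)

div-cong : ∀ t {f g} → f ≗ g → div t f ≗ div t g
div-cong t f≗g zero    = f≗g zero
div-cong t f≗g (suc n) = cong₂ (λ x y → x - t * y) (f≗g (suc n)) (div-cong t f≗g n)

mul-comm : ∀ a b f → mul a (mul b f) ≗ mul b (mul a f)
mul-comm a b f zero          = refl
mul-comm a b f (suc zero)    = lemma a b (f 1) (f 0)
  where
  lemma : ∀ a b x y → (x + b * y) + a * y ≡ (x + a * y) + b * y
  lemma = solve-∀ ℚring
mul-comm a b f (suc (suc n)) = lemma a b (f (suc (suc n))) (f (suc n)) (f n)
  where
  lemma : ∀ a b x y z → (x + b * y) + a * (y + b * z) ≡ (x + a * y) + b * (y + a * z)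
  lemma = solve-∀ ℚring

mul-div : ∀ t f → mul t (div t f) ≗ f
mul-div t f zero    = refl
mul-div t f (suc n) = lemma (f (suc n)) (t * div t f n)
  where
  lemma : ∀ x y → (x - y) + y ≡ x
  lemma = solve-∀ ℚring

div-mul : ∀ t f → div t (mul t f) ≗ f
div-mul t f zero    = refl
div-mul t f (suc n) = trans (cong (λ y → (f (suc n) + t * f n) - t * y) (div-mul t f n)) (lemma (f (suc n)) (t * f n))
  where
  lemma : ∀ x y → (x + y) - y ≡ x
  lemma = solve-∀ ℚring

-- Multiplications commute and `div t` is a two-sided inverse of `mul t`, so inserting `mul t` after
-- `div t` lets the two operators pass each other.
div-mul-comm : ∀ t a f → div t (mul a f) ≗ mul a (div t f)
div-mul-comm t a f n = begin
  div t (mul a f) n                     ≡⟨ div-cong t (mul-cong a (mul-div t f)) n ⟨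
  div t (mul a (mul t (div t f))) n     ≡⟨ div-cong t (mul-comm a t (div t f)) n ⟩
  div t (mul t (mul a (div t f))) n     ≡⟨ div-mul t (mul a (div t f)) n ⟩
  mul a (div t f) n                     ∎

div-comm : ∀ s t f → div s (div t f) ≗ div t (div s f)
div-comm s t f n = begin
  div s (div t f) n                     ≡⟨ div-cong s (div-cong t (mul-div s f)) n ⟨
  div s (div t (mul s (div s f))) n     ≡⟨ div-cong s (div-mul-comm t s (div s f)) n ⟩
  div s (mul s (div t (div s f))) n     ≡⟨ div-mul s (div t (div s f)) n ⟩
  div t (div s f) n                     ∎

-- Cauchy products.

infixl 7 _⋆_
_⋆_ : Series → Series → Series
(f ⋆ g) zero    = f 0 * g 0
(f ⋆ g) (suc m) = (f ∘ suc ⋆ g) m + f 0 * g (suc m)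

⋆-congˡ : ∀ {f f′} g → f ≗ f′ → f ⋆ g ≗ f′ ⋆ g
⋆-congˡ g f≗f′ zero    = cong (_* g 0) (f≗f′ 0)
⋆-congˡ g f≗f′ (suc m) = cong₂ (λ x y → x + y * g (suc m)) (⋆-congˡ g (f≗f′ ∘ suc) m) (f≗f′ 0)

⋆-linear : ∀ a f f′ g m → ((λ n → f n + a * f′ n) ⋆ g) m ≡ (f ⋆ g) m + a * (f′ ⋆ g) m
⋆-linear a f f′ g zero    = lemma a (f 0) (f′ 0) (g 0)
  where
  lemma : ∀ a x y z → (x + a * y) * z ≡ x * z + a * (y * z)
  lemma = solve-∀ ℚring
⋆-linear a f f′ g (suc m) = trans
  (cong (_+ (f 0 + a * f′ 0) * g (suc m)) (⋆-linear a (f ∘ suc) (f′ ∘ suc) g m))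
  (lemma a ((f ∘ suc ⋆ g) m) ((f′ ∘ suc ⋆ g) m) (f 0) (f′ 0) (g (suc m)))
  where
  lemma : ∀ a u v x y z → (u + a * v) + (x + a * y) * z ≡ (u + x * z) + a * (v + y * z)
  lemma = solve-∀ ℚring

mul-⋆ : ∀ a f g → mul a f ⋆ g ≗ mul a (f ⋆ g)
mul-⋆ a f g zero    = refl
mul-⋆ a f g (suc m) = trans (cong (_+ f 0 * g (suc m)) (⋆-linear a (f ∘ suc) f g m))
  (lemma ((f ∘ suc ⋆ g) m) (a * (f ⋆ g) m) (f 0 * g (suc m)))
  where
  lemma : ∀ x y z → (x + y) + z ≡ (x + z) + y
  lemma = solve-∀ ℚring

zero-⋆ : ∀ g m → ((λ _ → 0ℚ) ⋆ g) m ≡ 0ℚ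
zero-⋆ g zero    = ℚₚ.*-zeroˡ (g 0)
zero-⋆ g (suc m) = cong₂ _+_ (zero-⋆ g m) (ℚₚ.*-zeroˡ (g (suc m)))

one-⋆ : ∀ g → one ⋆ g ≗ g
one-⋆ g zero    = ℚₚ.*-identityˡ (g 0)
one-⋆ g (suc m) = trans (cong₂ _+_ (zero-⋆ g m) (ℚₚ.*-identityˡ (g (suc m)))) (ℚₚ.+-identityˡ (g (suc m)))

Σ≤ : ℕ → (ℕ → ℚ) → ℚ
Σ≤ zero    t = t 0
Σ≤ (suc m) t = Σ≤ m t + t (suc m)

Σ≤-cong : ∀ m {s t} → (∀ i → i ≤ m → s i ≡ t i) → Σ≤ m s ≡ Σ≤ m t
Σ≤-cong zero    s≡t = s≡t 0 z≤n
Σ≤-cong (suc m) s≡t = cong₂ _+_ (Σ≤-cong m λ i i≤m → s≡t i (ℕ.m≤n⇒m≤1+n i≤m)) (s≡t (suc m) ℕ.≤-refl)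

Σ≤-zero : ∀ m → Σ≤ m (λ _ → 0ℚ) ≡ 0ℚ
Σ≤-zero zero    = refl
Σ≤-zero (suc m) = cong (_+ 0ℚ) (Σ≤-zero m)

sumℚ-upTo : ∀ t m → sumℚ (map t (upTo (suc m))) ≡ Σ≤ m t
sumℚ-upTo t zero    = ℚₚ.+-identityʳ (t 0)
sumℚ-upTo t (suc m) = begin
  sumℚ (map t (upTo (suc (suc m))))                  ≡⟨ cong (sumℚ ∘ map t) (upTo-∷ʳ (suc m)) ⟨
  sumℚ (map t (upTo (suc m) ++ suc m ∷ []))          ≡⟨ cong sumℚ (map-++ t (upTo (suc m)) _) ⟩
  sumℚ (map t (upTo (suc m)) ++ t (suc m) ∷ [])      ≡⟨ sumℚ-++ (map t (upTo (suc m))) _ ⟩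
  sumℚ (map t (upTo (suc m))) + (t (suc m) + 0ℚ)     ≡⟨ cong₂ _+_ (sumℚ-upTo t m) (ℚₚ.+-identityʳ (t (suc m))) ⟩
  Σ≤ m t + t (suc m)                                 ∎

⋆-Σ : ∀ f g m → (f ⋆ g) m ≡ Σ≤ m (λ i → f (m ∸ i) * g i)
⋆-Σ f g zero    = refl
⋆-Σ f g (suc m) = cong₂ (λ x y → x + f y * g (suc m))
  (trans (⋆-Σ (f ∘ suc) g m) (Σ≤-cong m λ i i≤m → cong (λ y → f y * g i) (sym (ℕ.+-∸-assoc 1 i≤m))))
  (sym (ℕ.n∸n≡0 m))

div-zero : ∀ f → div 0ℚ f ≗ f
div-zero f zero    = refl
div-zero f (suc n) = lemma (f (suc n)) (div 0ℚ f n)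
  where
  lemma : ∀ x y → x - 0ℚ * y ≡ x
  lemma = solve-∀ ℚring

-- Factorial elementary symmetric functions

module Factorial (γ τ : ℕ → ℚ) where

  -- The product of 1 + γ_c s over j ≤ c < j + n, the generating function of the elementary
  -- symmetric polynomials in these γ_c.
  num : ℕ → ℕ → Series
  num j zero    = one
  num j (suc n) = mul (γ j) (num (suc j) n)

  den : ℕ → ℕ → Series → Series
  den t zero    f = f
  den t (suc n) f = div (τ t) (den (suc t) n f)

  -- With variables γ_j, …, γ_{K-1} and parameters τ_t, τ_{t+1}, ….
  F : (t K j m : ℕ) → ℚ
  F t K j m = den t (suc (K ∸ j) ∸ m) (num j (K ∸ j)) m

  num-head : ∀ j n → num j n 0 ≡ 1ℚ
  num-head j zero    = refl
  num-head j (suc n) = num-head (suc j) n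

  num-degree : ∀ j n m → n < m → num j n m ≡ 0ℚ
  num-degree j zero    (suc m) _       = refl
  num-degree j (suc n) (suc m) (s≤s n<m) = begin
    num (suc j) n (suc m) + γ j * num (suc j) n m
      ≡⟨ cong₂ (λ x y → x + γ j * y) (num-degree (suc j) n (suc m) (ℕ.m≤n⇒m≤1+n n<m)) (num-degree (suc j) n m n<m) ⟩
    0ℚ + γ j * 0ℚ ≡⟨ trans (ℚₚ.+-identityˡ (γ j * 0ℚ)) (ℚₚ.*-zeroʳ (γ j)) ⟩
    0ℚ ∎

  num-last : ∀ j n → num j (suc n) ≗ mul (γ (j ℕ.+ n)) (num j n)
  num-last j zero    m rewrite ℕ.+-identityʳ j = refl
  num-last j (suc n) m rewrite ℕ.+-suc j n =
    trans (mul-cong (γ j) (num-last (suc j) n) m) (mul-comm (γ j) (γ (suc (j ℕ.+ n))) (num (suc j) n) m)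

  -- The function `f` makes the induction go through: passing to the tail of `applyUpTo f` replaces
  -- `f` by `f ∘ suc`, that is, j by j + 1.
  num-esym : ∀ j n f → (∀ i → f i ≡ i ℕ.+ j) → num j n ≗ esym (map γ (applyUpTo f n))
  num-esym j zero    f _   zero    = refl
  num-esym j zero    f _   (suc m) = refl
  num-esym j (suc n) f f≡ zero    =
    trans (num-head j (suc n)) (sym (esym-zero (map γ (applyUpTo f (suc n)))))
  num-esym j (suc n) f f≡ (suc m) = begin
    num (suc j) n (suc m) + γ j * num (suc j) n m       ≡⟨ cong₂ (λ x y → x + γ j * y) (ih (suc m)) (ih m) ⟩
    esym xs (suc m) + γ j * esym xs m                   ≡⟨ cong (λ i → esym xs (suc m) + γ i * esym xs m) (f≡ 0) ⟨
    esym xs (suc m) + γ (f 0) * esym xs m               ≡⟨ esym-∷ (γ (f 0)) xs m ⟨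
    esym (γ (f 0) ∷ xs) (suc m)                         ∎
    where
    xs = map γ (applyUpTo (f ∘ suc) n)
    ih = num-esym (suc j) n (f ∘ suc) (λ i → trans (f≡ (suc i)) (sym (ℕ.+-suc i j)))

  den-cong : ∀ t n {f g} → f ≗ g → den t n f ≗ den t n g
  den-cong t zero    f≗g = f≗g
  den-cong t (suc n) f≗g = div-cong (τ t) (den-cong (suc t) n f≗g)

  den-head : ∀ t n f → den t n f 0 ≡ f 0
  den-head t zero    f = refl
  den-head t (suc n) f = den-head (suc t) n f

  den-mul : ∀ t n a f → den t n (mul a f) ≗ mul a (den t n f)
  den-mul t zero    a f m = refl
  den-mul t (suc n) a f m =
    trans (div-cong (τ t) (den-mul (suc t) n a f) m) (div-mul-comm (τ t) a (den (suc t) n f) m)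

  den-last : ∀ t n f → den t (suc n) f ≗ div (τ (t ℕ.+ n)) (den t n f)
  den-last t zero    f m rewrite ℕ.+-identityʳ t = refl
  den-last t (suc n) f m rewrite ℕ.+-suc t n =
    trans (div-cong (τ t) (den-last (suc t) n f) m) (div-comm (τ t) (τ (suc (t ℕ.+ n))) (den (suc t) n f) m)

  F-zero : ∀ t K j → F t K j 0 ≡ 1ℚ
  F-zero t K j = trans (den-head t (suc (K ∸ j)) (num j (K ∸ j))) (num-head j (K ∸ j))

  -- Truncated subtraction leaves no denominator here, and the numerator has degree at most K - j in
  -- s.
  F-vanish : ∀ t K j m → K ∸ j < m → F t K j m ≡ 0ℚ
  F-vanish t K j m lt rewrite ℕ.m≤n⇒m∸n≡0 lt = num-degree j (K ∸ j) m lt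

  private
    -- `F` in terms of the number n of variables rather than the end K of their range.
    G : (t n j m : ℕ) → ℚ
    G t n j m = den t (suc n ∸ m) (num j n) m

    G-vanish : ∀ t n j m → n < m → G t n j m ≡ 0ℚ
    G-vanish t n j m lt rewrite ℕ.m≤n⇒m∸n≡0 lt = num-degree j n m lt

    -- Write 1 + γ_j s = (1 + τ_t s) + (γ_j - τ_t) s. The first summand cancels the first
    -- denominator; the second keeps all denominators and lowers the degree by one. The number of
    -- denominators that remain is in both cases the one `G` prescribes.
    G-recurrence : ∀ t n j m →
      G t (suc n) j (suc m) ≡ (γ j - τ t) * G t n (suc j) m + G (suc t) n (suc j) (suc m)
    G-recurrence t n j m with ℕ.≤-<-connex m n
    ... | inj₁ m≤n rewrite ℕ.+-∸-assoc 1 m≤n = begin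
      den t (suc N) (mul (γ j) P) (suc m)              ≡⟨ den-mul t (suc N) (γ j) P (suc m) ⟩
      (Q (suc m) - τ t * R m) + γ j * R m              ≡⟨ lemma (Q (suc m)) (τ t) (γ j) (R m) ⟩
      (γ j - τ t) * R m + Q (suc m)                    ∎
      where
      N = n ∸ m
      P = num (suc j) n
      Q = den (suc t) N P
      R = div (τ t) Q
      lemma : ∀ q t g r → (q - t * r) + g * r ≡ (g - t) * r + q
      lemma = solve-∀ ℚring
    ... | inj₂ n<m = begin
      G t (suc n) j (suc m)                                          ≡⟨ G-vanish t (suc n) j (suc m) (s≤s n<m) ⟩
      0ℚ                                                             ≡⟨ lemma (γ j - τ t) ⟨
      (γ j - τ t) * 0ℚ + 0ℚ                                          ≡⟨ cong₂ (λ x y → (γ j - τ t) * x + y) (G-vanish t n (suc j) m n<m) (G-vanish (suc t) n (suc j) (suc m) (ℕ.m≤n⇒m≤1+n n<m)) ⟨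
      (γ j - τ t) * G t n (suc j) m + G (suc t) n (suc j) (suc m)    ∎
      where
      lemma : ∀ x → x * 0ℚ + 0ℚ ≡ 0ℚ
      lemma = solve-∀ ℚring

    -- The numerator factor of the last variable cancels the first denominator.
    G-cancel : ∀ t n j m → γ (j ℕ.+ n) ≡ τ t → G t (suc n) j m ≡ G (suc t) n j m
    G-cancel t n j m γ≡τ with ℕ.≤-<-connex m (suc n)
    ... | inj₁ m≤1+n rewrite ℕ.+-∸-assoc 1 m≤1+n = begin
      div (τ t) (den (suc t) N (num j (suc n))) m                   ≡⟨ div-cong (τ t) (den-cong (suc t) N (num-last j n)) m ⟩
      div (τ t) (den (suc t) N (mul (γ (j ℕ.+ n)) (num j n))) m     ≡⟨ div-cong (τ t) (den-mul (suc t) N (γ (j ℕ.+ n)) (num j n)) m ⟩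
      div (τ t) (mul (γ (j ℕ.+ n)) (den (suc t) N (num j n))) m     ≡⟨ cong (λ x → div (τ t) (mul x (den (suc t) N (num j n))) m) γ≡τ ⟩
      div (τ t) (mul (τ t) (den (suc t) N (num j n))) m             ≡⟨ div-mul (τ t) (den (suc t) N (num j n)) m ⟩
      den (suc t) N (num j n) m                                     ∎
      where N = suc n ∸ m
    ... | inj₂ 1+n<m = trans (G-vanish t (suc n) j m 1+n<m) (sym (G-vanish (suc t) n j m (ℕ.<⇒≤ 1+n<m)))

  F-recurrence : ∀ t K j m → j < K →
    F t K j (suc m) ≡ (γ j - τ t) * F t K (suc j) m + F (suc t) K (suc j) (suc m)
  F-recurrence t (suc K) j m (s≤s j≤K) rewrite ℕ.+-∸-assoc 1 j≤K = G-recurrence t (K ∸ j) j m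

  F-cancel : ∀ t K j m → γ K ≡ τ t → F t (suc K) j m ≡ F (suc t) K j m
  F-cancel t K j m γ≡τ with ℕ.≤-<-connex j K
  ... | inj₁ j≤K rewrite ℕ.+-∸-assoc 1 j≤K =
    G-cancel t (K ∸ j) j m (trans (cong γ (ℕ.m+[n∸m]≡n j≤K)) γ≡τ)
  -- For K < j neither side has a variable left, so both are 1 in degree 0 and 0 in higher degrees.
  F-cancel t K j zero    γ≡τ | inj₂ K<j = trans (F-zero t (suc K) j) (sym (F-zero (suc t) K j))
  F-cancel t K j (suc m) γ≡τ | inj₂ K<j = trans
    (F-vanish t (suc K) j (suc m) (subst (_< suc m) (sym (ℕ.m≤n⇒m∸n≡0 K<j)) (s≤s z≤n)))
    (sym (F-vanish (suc t) K j (suc m) (subst (_< suc m) (sym (ℕ.m≤n⇒m∸n≡0 (ℕ.<⇒≤ K<j))) (s≤s z≤n))))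

  -- Variables and parameters are paired in opposite orders: each round removes the last variable
  -- together with the first parameter.
  F-cancels : ∀ q t K j m → (∀ i → i < q → γ (K ℕ.+ i) ≡ τ (t ℕ.+ (q ∸ suc i))) →
    F t (K ℕ.+ q) j m ≡ F (t ℕ.+ q) K j m
  F-cancels zero    t K j m γ≡τ = cong₂ (λ x y → F x y j m) (sym (ℕ.+-identityʳ t)) (ℕ.+-identityʳ K)
  F-cancels (suc q) t K j m γ≡τ = begin
    F t (K ℕ.+ suc q) j m     ≡⟨ cong (λ x → F t x j m) (ℕ.+-suc K q) ⟩
    F t (suc (K ℕ.+ q)) j m   ≡⟨ F-cancel t (K ℕ.+ q) j m (trans (γ≡τ q ℕ.≤-refl) (cong τ (trans (cong (t ℕ.+_) (ℕ.n∸n≡0 q)) (ℕ.+-identityʳ t)))) ⟩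
    F (suc t) (K ℕ.+ q) j m   ≡⟨ F-cancels q (suc t) K j m (λ i i<q → trans (γ≡τ i (ℕ.m≤n⇒m≤1+n i<q)) (cong τ (index i i<q))) ⟩
    F (suc t ℕ.+ q) K j m     ≡⟨ cong (λ x → F x K j m) (ℕ.+-suc t q) ⟨
    F (t ℕ.+ suc q) K j m     ∎
    where
    index : ∀ i → i < q → t ℕ.+ (q ∸ i) ≡ suc t ℕ.+ (q ∸ suc i)
    index i i<q = trans (cong (t ℕ.+_) (ℕ.+-∸-assoc 1 i<q)) (ℕ.+-suc t (q ∸ suc i))

  -- The two hypotheses characterise `U n` as the inverse of the product of 1 + τ_r s over 1 ≤ r ≤
  -- n.
  den-⋆ : (U : ℕ → Series) → U 0 ≗ one → (∀ n → mul (τ (suc n)) (U (suc n)) ≗ U n) →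
    ∀ n f → den 1 n f ≗ U n ⋆ f
  den-⋆ U U₀ U-step zero    f m = sym (trans (⋆-congˡ f U₀ m) (one-⋆ f m))
  den-⋆ U U₀ U-step (suc n) f m = begin
    den 1 (suc n) f m                                       ≡⟨ den-last 1 n f m ⟩
    div (τ (suc n)) (den 1 n f) m                           ≡⟨ div-cong (τ (suc n)) (den-⋆ U U₀ U-step n f) m ⟩
    div (τ (suc n)) (U n ⋆ f) m                             ≡⟨ div-cong (τ (suc n)) (⋆-congˡ f (U-step n)) m ⟨
    div (τ (suc n)) (mul (τ (suc n)) (U (suc n)) ⋆ f) m     ≡⟨ div-cong (τ (suc n)) (mul-⋆ (τ (suc n)) (U (suc n)) f) m ⟩
    div (τ (suc n)) (mul (τ (suc n)) (U (suc n) ⋆ f)) m     ≡⟨ div-mul (τ (suc n)) (U (suc n) ⋆ f) m ⟩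
    (U (suc n) ⋆ f) m                                       ∎

-- Stirling polynomials

module Stirling (S : ℕ → Poly) (isStirling : IsStirling S) where

  -- At a positive integer ℓ this is σ_j(ℓ, ..., 1), an unsigned Stirling number of the first kind.
  c : ℕ → ℚ → ℚ
  c j x = binomQ x j * eval (S j) x

  c-polynomial : ∀ j → IsPolynomial (c j)
  c-polynomial j = *-polynomial (binomQ-polynomial j) (S j , λ x → refl)

  c-zero : ∀ x → c 0 x ≡ 1ℚ
  c-zero = polynomial-ext (c-polynomial 0) (const-polynomial 1ℚ) 1 λ where
    (suc n) _ → isStirling 0 (suc n) (s≤s z≤n)

  -- At an integer n this sorts the products in σ_{j+1}(n, ..., 1) by whether they contain n; both
  -- sides are polynomials.
  c-recurrence : ∀ j x → c (suc j) x ≡ c (suc j) (x - 1ℚ) + x * c j (x - 1ℚ)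
  c-recurrence j = polynomial-ext (c-polynomial (suc j))
    -- From 2 on both n and n - 1 are positive, where the defining property of `S` applies.
    (+-polynomial (shifted (suc j)) (*-polynomial id-polynomial (shifted j))) 2 step
    where
    shifted : ∀ i → IsPolynomial (λ x → c i (x - 1ℚ))
    shifted i = ∘-polynomial (c-polynomial i) (difference-polynomial id-polynomial (const-polynomial 1ℚ))
    predecessor : ∀ n → ℕtoℚ n ≡ ℕtoℚ (suc n) - 1ℚ
    predecessor n = trans (lemma (ℕtoℚ n)) (cong (_- 1ℚ) (sym (ℕtoℚ-suc n)))
      where
      lemma : ∀ x → x ≡ (x + 1ℚ) - 1ℚ
      lemma = solve-∀ ℚring
    step : ∀ n → 2 ≤ n → c (suc j) (ℕtoℚ n) ≡ c (suc j) (ℕtoℚ n - 1ℚ) + ℕtoℚ n * c j (ℕtoℚ n - 1ℚ)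
    step (suc n@(suc _)) (s≤s 1≤n) = begin
      c (suc j) (ℕtoℚ (suc n))
        ≡⟨ isStirling (suc j) (suc n) (s≤s z≤n) ⟩
      esym (ℕtoℚ (suc n) ∷ xs) (suc j)
        ≡⟨ esym-∷ (ℕtoℚ (suc n)) xs j ⟩
      esym xs (suc j) + ℕtoℚ (suc n) * esym xs j
        ≡⟨ cong₂ (λ y z → y + ℕtoℚ (suc n) * z) (isStirling (suc j) n 1≤n) (isStirling j n 1≤n) ⟨
      c (suc j) (ℕtoℚ n) + ℕtoℚ (suc n) * c j (ℕtoℚ n)
        ≡⟨ cong (λ y → c (suc j) y + ℕtoℚ (suc n) * c j y) (predecessor n) ⟩
      c (suc j) (ℕtoℚ (suc n) - 1ℚ) + ℕtoℚ (suc n) * c j (ℕtoℚ (suc n) - 1ℚ) ∎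
      where
      xs = map ℕtoℚ (map suc (downFrom n))

  -- U n j = (-1)^j h_j(1, …, n): by U-zero and U-step, U n is the inverse of (1 + s) ⋯ (1 + n s).
  U : ℕ → Series
  U n j = binomQ (ℕtoℚ n + ℕtoℚ j) j * eval (S j) (- ℕtoℚ n - 1ℚ)

  U-c : ∀ n j → U n j ≡ sign j * c j (- ℕtoℚ n - 1ℚ)
  U-c n j = trans (cong (_* e) (binomQ-negation (ℕtoℚ n) j)) (ℚₚ.*-assoc (sign j) (binomQ (- ℕtoℚ n - 1ℚ) j) e)
    where e = eval (S j) (- ℕtoℚ n - 1ℚ)

  U-head : ∀ n → U n 0 ≡ 1ℚ
  U-head n = c-zero (- ℕtoℚ n - 1ℚ)

  c-suc-at-zero : ∀ j → c (suc j) 0ℚ ≡ 0ℚ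
  c-suc-at-zero j = trans (cong (_* e) (binomQ≡0 0 (suc j) (s≤s z≤n))) (ℚₚ.*-zeroˡ e)
    where e = eval (S (suc j)) 0ℚ

  -- `U 0` involves `c` at -1. The second term of the recurrence vanishes at 0, so for positive
  -- index the value at -1 equals the value at 0, where the binomial factor is zero.
  U-zero : U 0 ≗ one
  U-zero zero    = U-head 0
  U-zero (suc j) = begin
    U 0 (suc j)                            ≡⟨ U-c 0 (suc j) ⟩
    sign (suc j) * c (suc j) (0ℚ - 1ℚ)     ≡⟨ cong (sign (suc j) *_) c≡0 ⟩
    sign (suc j) * 0ℚ                      ≡⟨ ℚₚ.*-zeroʳ (sign (suc j)) ⟩
    0ℚ                                     ∎
    where
    lemma : ∀ x y → x ≡ x + 0ℚ * y
    lemma = solve-∀ ℚring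
    c≡0 : c (suc j) (0ℚ - 1ℚ) ≡ 0ℚ
    c≡0 = begin
      c (suc j) (0ℚ - 1ℚ)                           ≡⟨ lemma (c (suc j) (0ℚ - 1ℚ)) (c j (0ℚ - 1ℚ)) ⟩
      c (suc j) (0ℚ - 1ℚ) + 0ℚ * c j (0ℚ - 1ℚ)      ≡⟨ c-recurrence j 0ℚ ⟨
      c (suc j) 0ℚ                                  ≡⟨ c-suc-at-zero j ⟩
      0ℚ                                            ∎

  -- This is `c-recurrence` at x = -(n + 1), up to sign.
  U-step : ∀ n → mul (ℕtoℚ (suc n)) (U (suc n)) ≗ U n
  U-step n zero    = trans (U-head (suc n)) (sym (U-head n))
  U-step n (suc j) = begin
    U (suc n) (suc j) + N * U (suc n) j
      ≡⟨ cong₂ (λ x y → x + N * y) (U-c (suc n) (suc j)) (U-c (suc n) j) ⟩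
    - sign j * c (suc j) (- N - 1ℚ) + N * (sign j * c j (- N - 1ℚ))
      ≡⟨ lemma (sign j) (c (suc j) (- N - 1ℚ)) N (c j (- N - 1ℚ)) ⟩
    - sign j * (c (suc j) (- N - 1ℚ) + - N * c j (- N - 1ℚ))
      ≡⟨ cong (- sign j *_) (c-recurrence j (- N)) ⟨
    - sign j * c (suc j) (- N)
      ≡⟨ cong (λ x → - sign j * c (suc j) x) (trans (cong -_ (ℕtoℚ-suc n)) (negate (ℕtoℚ n))) ⟩
    - sign j * c (suc j) (- ℕtoℚ n - 1ℚ)
      ≡⟨ U-c n (suc j) ⟨
    U n (suc j) ∎
    where
    N = ℕtoℚ (suc n)
    lemma : ∀ s x n y → - s * x + n * (s * y) ≡ - s * (x + - n * y)
    lemma = solve-∀ ℚring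
    negate : ∀ x → - (x + 1ℚ) ≡ - x - 1ℚ
    negate = solve-∀ ℚring

  coefficient : ℕ → ℕ → ℕ → ℚ
  coefficient k m i = binomQ (ℕtoℚ k - ℕtoℚ i) (m ∸ i) * eval (S (m ∸ i)) (ℕtoℚ m - ℕtoℚ k - 1ℚ)

  rhs-Σ : ∀ λ′ m → rhs S λ′ m ≡ Σ≤ m (λ i → coefficient (row λ′ 1) m i * esym (firstRowHooks λ′) i)
  rhs-Σ λ′ m = sumℚ-upTo (λ i → coefficient (row λ′ 1) m i * esym (firstRowHooks λ′) i) m

  -- Since k - i = (k - m) + (m - i) and m - k - 1 = -(k - m) - 1, the coefficient of σ_i is
  -- `U (k ∸ m) (m ∸ i)`, and the sum is a Cauchy product.
  rhs-F : ∀ λ′ m → m ≤ row λ′ 1 →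
    rhs S λ′ m ≡ Factorial.F (λ j → ℕtoℚ (hook λ′ (1 , suc j))) ℕtoℚ 0 (row λ′ 1) 0 m
  rhs-F λ′ m m≤k = begin
    rhs S λ′ m                                ≡⟨ rhs-Σ λ′ m ⟩
    Σ≤ m _                                    ≡⟨ Σ≤-cong m terms ⟩
    Σ≤ m (λ i → U (k ∸ m) (m ∸ i) * num 0 k i) ≡⟨ ⋆-Σ (U (k ∸ m)) (num 0 k) m ⟨
    (U (k ∸ m) ⋆ num 0 k) m                   ≡⟨ den-⋆ U U-zero U-step (k ∸ m) (num 0 k) m ⟨
    -- The parameters of `F` start at 0, and the factor for parameter 0 is trivial.
    den 1 (k ∸ m) (num 0 k) m                 ≡⟨ div-zero (den 1 (k ∸ m) (num 0 k)) m ⟨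
    den 0 (suc (k ∸ m)) (num 0 k) m           ≡⟨ cong (λ n → den 0 n (num 0 k) m) (ℕ.+-∸-assoc 1 m≤k) ⟨
    F 0 k 0 m                                 ∎
    where
    k = row λ′ 1
    open Factorial (λ j → ℕtoℚ (hook λ′ (1 , suc j))) ℕtoℚ
    shift : ∀ k m i → k - i ≡ (k - m) + (m - i)
    shift = solve-∀ ℚring
    negate : ∀ k m → m - k - 1ℚ ≡ - (k - m) - 1ℚ
    negate = solve-∀ ℚring
    terms : ∀ i → i ≤ m → coefficient k m i * esym (firstRowHooks λ′) i ≡ U (k ∸ m) (m ∸ i) * num 0 k i
    terms i i≤m = cong₂ _*_ (cong₂ (λ x y → binomQ x (m ∸ i) * eval (S (m ∸ i)) y)
      (trans (shift (ℕtoℚ k) (ℕtoℚ m) (ℕtoℚ i)) (sym (cong₂ _+_ (ℕtoℚ-∸ m≤k) (ℕtoℚ-∸ i≤m))))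
      (trans (negate (ℕtoℚ k) (ℕtoℚ m)) (cong (λ x → - x - 1ℚ) (sym (ℕtoℚ-∸ m≤k)))))
      (sym (num-esym 0 k id (λ j → sym (ℕ.+-identityʳ j)) i))

  -- For i ≤ k the binomial coefficient is zero because 0 ≤ k - i < m - i; for i > k there are too
  -- few variables for σ_i.
  rhs-vanish : ∀ λ′ m → row λ′ 1 < m → rhs S λ′ m ≡ 0ℚ
  rhs-vanish λ′ m k<m = trans (rhs-Σ λ′ m) (trans (Σ≤-cong m terms) (Σ≤-zero m))
    where
    k = row λ′ 1
    hooks = firstRowHooks λ′
    hooks-length : length hooks ≡ k
    hooks-length = trans (length-map _ (upTo k)) (length-applyUpTo id k)
    terms : ∀ i → i ≤ m → coefficient k m i * esym hooks i ≡ 0ℚ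
    terms i i≤m with ℕ.≤-<-connex i k
    ... | inj₁ i≤k = begin
      b * e * s    ≡⟨ cong (λ x → x * e * s) (trans (cong (λ x → binomQ x (m ∸ i)) (sym (ℕtoℚ-∸ i≤k))) (binomQ≡0 (k ∸ i) (m ∸ i) (ℕ.∸-monoˡ-< k<m i≤k))) ⟩
      0ℚ * e * s   ≡⟨ lemma e s ⟩
      0ℚ           ∎
      where
      b = binomQ (ℕtoℚ k - ℕtoℚ i) (m ∸ i)
      e = eval (S (m ∸ i)) (ℕtoℚ m - ℕtoℚ k - 1ℚ)
      s = esym hooks i
      lemma : ∀ e s → 0ℚ * e * s ≡ 0ℚ
      lemma = solve-∀ ℚring
    ... | inj₂ k<i = trans
      (cong (coefficient k m i *_) (esym≡0 hooks i (subst (_< i) (sym hooks-length) k<i)))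
      (ℚₚ.*-zeroʳ (coefficient k m i))

-- Excited diagrams

row-head : ∀ {x xs} → Linked ℕ._≥_ (x ∷ xs) → ∀ i → row xs (suc i) ≤ x
row-head [-]           i       = z≤n
row-head (x≥y ∷ _)     zero    = x≥y
row-head (x≥y ∷ links) (suc i) = ℕ.≤-trans (row-head links i) x≥y

row-antitone : ∀ {xs} → Linked ℕ._≥_ xs → ∀ i → row xs (suc (suc i)) ≤ row xs (suc i)
row-antitone {[]}     links i       = z≤n
row-antitone {x ∷ xs} links zero    = row-head links 0
row-antitone {x ∷ xs} links (suc i) = row-antitone (Linked.tail links) i

row≤first : ∀ {xs} → Linked ℕ._≥_ xs → ∀ i → row xs (suc i) ≤ row xs 1
row≤first links zero    = ℕ.≤-refl
row≤first links (suc i) = ℕ.≤-trans (row-antitone links i) (row≤first links i)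

col-≥ : ∀ {xs} → Linked ℕ._≥_ xs → ∀ i j → suc j ≤ row xs (suc i) → suc i ≤ col xs (suc j)
col-≥ {x ∷ xs} links zero    j j<x rewrite filter-accept (suc j ≤?_) {xs = xs} j<x = s≤s z≤n
col-≥ {x ∷ xs} links (suc i) j j<r
  rewrite filter-accept (suc j ≤?_) {xs = xs} (ℕ.≤-trans j<r (row-head links i)) =
  s≤s (col-≥ (Linked.tail links) i j j<r)

col-≤ : ∀ {xs} → Linked ℕ._≥_ xs → ∀ i j → row xs (suc i) < j → col xs j ≤ i
col-≤ {[]}     links i       j r<j = z≤n
col-≤ {x ∷ xs} links zero    j r<j rewrite filter-reject (j ≤?_) {xs = xs} (ℕ.<⇒≱ r<j) =
  col-≤ (Linked.tail links) zero j (ℕ.≤-<-trans (row-head links 0) r<j)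
col-≤ {x ∷ xs} links (suc i) j r<j with j ≤? x
... | yes j≤x rewrite filter-accept (j ≤?_) {xs = xs} j≤x = s≤s (col-≤ (Linked.tail links) i j r<j)
... | no  j≰x rewrite filter-reject (j ≤?_) {xs = xs} j≰x = ℕ.m≤n⇒m≤1+n (col-≤ (Linked.tail links) i j r<j)

-- Configurations with one pebble on each diagonal.

SameSet-refl : ∀ {m} {v : Config m} → SameSet v v
SameSet-refl c = id , id

-- The p-th pebble lies on the diagonal through (i , j + p).
OnDiagonals : ℕ → ℕ → ∀ {m} → Config m → Set
OnDiagonals i j []            = ⊤
OnDiagonals i j ((a , b) ∷ v) = a ℕ.+ j ≡ i ℕ.+ b × OnDiagonals i (suc j) v

diagonal-≥ : ∀ {i j m a b} (v : Config m) → OnDiagonals i j v → (a , b) ∈ v → a ℕ.+ j ≤ i ℕ.+ b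
diagonal-≥ (_ ∷ v) (eq , _) (here refl) = ℕ.≤-reflexive eq
diagonal-≥ {i} {j} {a = a} (_ ∷ v) (_ , ds) (there c∈v) =
  ℕ.≤-trans (ℕ.+-monoʳ-≤ a (ℕ.n≤1+n j)) (diagonal-≥ v ds c∈v)

tail-avoids-diagonal : ∀ {i j m a b} (v : Config m) → OnDiagonals i (suc j) v →
  a ℕ.+ j ≡ i ℕ.+ b → ¬ ((a , b) ∈ v)
tail-avoids-diagonal {i} {j} {a = a} {b} v ds eq c∈v =
  ℕ.<-irrefl eq (subst (_≤ i ℕ.+ b) (ℕ.+-suc a j) (diagonal-≥ v ds c∈v))

OnDiagonals-shift : ∀ {i j m} (v : Config m) → OnDiagonals (suc i) (suc j) v → OnDiagonals i j v
OnDiagonals-shift         []            _         = tt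
OnDiagonals-shift {i} {j} ((a , b) ∷ v) (eq , ds) =
  ℕ.suc-injective (trans (sym (ℕ.+-suc a j)) eq) , OnDiagonals-shift v ds

-- The diagonal of a cell tells which pebble occupies it: the head cannot recur in a tail, whose
-- pebbles lie on later diagonals. So a set of cells determines the vector.
SameSet⇒≡ : ∀ {i j m} (v w : Config m) → OnDiagonals i j v → OnDiagonals i j w → SameSet v w → v ≡ w
SameSet⇒≡ []      []      _          _          _    = refl
SameSet⇒≡ (c ∷ v) (d ∷ w) (c-eq , v-ds) (d-eq , w-ds) same with proj₁ (same c) (here refl)
... | there c∈w = contradiction c∈w (tail-avoids-diagonal w w-ds c-eq)
... | here refl = cong (c ∷_) (SameSet⇒≡ v w v-ds w-ds λ x →
  (λ x∈v → drop w v v-ds x∈v (proj₁ (same x) (there x∈v))) ,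
  (λ x∈w → drop v w w-ds x∈w (proj₂ (same x) (there x∈w))))
  where
  drop : ∀ (u u′ : Config _) → OnDiagonals _ _ u′ → ∀ {x} → x ∈ u′ → x ∈ c ∷ u → x ∈ u
  drop u u′ ds x∈u′ (here refl) = contradiction x∈u′ (tail-avoids-diagonal u′ ds c-eq)
  drop u u′ ds x∈u′ (there x∈u) = x∈u

sumℚ-↭ : ∀ {xs ys} → xs ↭ ys → sumℚ xs ≡ sumℚ ys
sumℚ-↭ p = ↭ₛ.foldr-commMonoid (setoid ℚ) ℚₚ.+-0-isCommutativeMonoid (↭⇒↭ₛ p)

-- Hook lengths and the boundary path.

module Diagram (λ′ : Partition) (links : Linked ℕ._≥_ λ′) where

  -- Rows and columns are counted from 0 here.
  R : ℕ → ℕ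
  R i = row λ′ (suc i)

  γ : ℕ → ℕ
  γ j = hook λ′ (1 , suc j)

  -- The number of the vertical boundary step of row `i`: before it come `i` vertical steps and
  -- `R 0 ∸ R i` horizontal ones.
  ρ : ℕ → ℕ
  ρ i = i ℕ.+ (R 0 ∸ R i)

  -- Going up column `j` to the first row lengthens the leg by `i` and the arm by `R 0 ∸ R i`.
  hook-difference : ∀ i j → suc j ≤ R i → hook λ′ (suc i , suc j) ℕ.+ ρ i ≡ γ j
  hook-difference i j j<r with col λ′ (suc j) | col-≥ links i j j<r
  ... | suc c | s≤s i≤c = begin
    (R i ∸ suc j) ℕ.+ (c ∸ i) ℕ.+ 1 ℕ.+ (i ℕ.+ (R 0 ∸ R i))   ≡⟨ lemma (R i ∸ suc j) (c ∸ i) i (R 0 ∸ R i) ⟩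
    ((R 0 ∸ R i) ℕ.+ (R i ∸ suc j)) ℕ.+ (i ℕ.+ (c ∸ i)) ℕ.+ 1  ≡⟨ cong₂ (λ x y → x ℕ.+ y ℕ.+ 1) arm (ℕ.m+[n∸m]≡n i≤c) ⟩
    (R 0 ∸ suc j) ℕ.+ c ℕ.+ 1                                 ∎
    where
    lemma : ∀ a c i b → a ℕ.+ c ℕ.+ 1 ℕ.+ (i ℕ.+ b) ≡ (b ℕ.+ a) ℕ.+ (i ℕ.+ c) ℕ.+ 1
    lemma = ℕRing.solve-∀
    arm : (R 0 ∸ R i) ℕ.+ (R i ∸ suc j) ≡ R 0 ∸ suc j
    arm = trans (sym (ℕ.+-∸-assoc (R 0 ∸ R i) j<r)) (cong (_∸ suc j) (ℕ.m∸n+n≡m (row≤first links i)))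

  -- These columns end in row `i`, so their boundary steps lie between those of rows `i` and
  -- `i + 1`, numbered from right to left. This is the pairing that `F-cancels` asks for.
  γ-between-rows : ∀ i x → x < R i ∸ R (suc i) →
    γ (R (suc i) ℕ.+ x) ≡ suc (ρ i) ℕ.+ ((R i ∸ R (suc i)) ∸ suc x)
  γ-between-rows i x x<q = begin
    (R 0 ∸ suc j) ℕ.+ (col λ′ (suc j) ∸ 1) ℕ.+ 1   ≡⟨ cong₂ (λ x y → x ℕ.+ (y ∸ 1) ℕ.+ 1) arm column ⟩
    ((R 0 ∸ R i) ℕ.+ (q ∸ suc x)) ℕ.+ i ℕ.+ 1      ≡⟨ lemma (R 0 ∸ R i) (q ∸ suc x) i ⟩
    suc (ρ i) ℕ.+ (q ∸ suc x)                      ∎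
    where
    j = R (suc i) ℕ.+ x
    q = R i ∸ R (suc i)
    j<r : suc j ≤ R i
    j<r = subst₂ _≤_ (ℕ.+-suc (R (suc i)) x) (ℕ.m+[n∸m]≡n (row-antitone links i)) (ℕ.+-monoʳ-≤ (R (suc i)) x<q)
    column : col λ′ (suc j) ≡ suc i
    column = ℕ.≤-antisym (col-≤ links (suc i) (suc j) (s≤s (ℕ.m≤m+n (R (suc i)) x))) (col-≥ links i j j<r)
    lemma : ∀ a b i → (a ℕ.+ b) ℕ.+ i ℕ.+ 1 ≡ suc (i ℕ.+ a) ℕ.+ b
    lemma = ℕRing.solve-∀
    arm : R 0 ∸ suc j ≡ (R 0 ∸ R i) ℕ.+ (q ∸ suc x)
    arm = begin
      R 0 ∸ suc j                          ≡⟨ cong (_∸ suc j) (ℕ.m∸n+n≡m (row≤first links i)) ⟨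
      ((R 0 ∸ R i) ℕ.+ R i) ∸ suc j        ≡⟨ ℕ.+-∸-assoc (R 0 ∸ R i) j<r ⟩
      (R 0 ∸ R i) ℕ.+ (R i ∸ suc j)        ≡⟨ cong (λ y → (R 0 ∸ R i) ℕ.+ (R i ∸ y)) (ℕ.+-suc (R (suc i)) x) ⟨
      (R 0 ∸ R i) ℕ.+ (R i ∸ (R (suc i) ℕ.+ suc x)) ≡⟨ cong ((R 0 ∸ R i) ℕ.+_) (ℕ.∸-+-assoc (R i) (R (suc i)) (suc x)) ⟨
      (R 0 ∸ R i) ℕ.+ (q ∸ suc x)          ∎

  ρ-suc : ∀ i → suc (ρ i) ℕ.+ (R i ∸ R (suc i)) ≡ ρ (suc i)
  ρ-suc i = begin
    suc (ρ i) ℕ.+ (R i ∸ R (suc i))                        ≡⟨ cong suc (ℕ.+-assoc i _ _) ⟩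
    suc i ℕ.+ ((R 0 ∸ R i) ℕ.+ (R i ∸ R (suc i)))          ≡⟨ cong (suc i ℕ.+_) (ℕ.+-∸-assoc (R 0 ∸ R i) (row-antitone links i)) ⟨
    suc i ℕ.+ (((R 0 ∸ R i) ℕ.+ R i) ∸ R (suc i))          ≡⟨ cong (λ x → suc i ℕ.+ (x ∸ R (suc i))) (ℕ.m∸n+n≡m (row≤first links i)) ⟩
    ρ (suc i)                                              ∎

  -- The excited diagrams of m pebbles started at (i , j), (i , j + 1), …; f bounds the
  -- number of columns.
  excited : (f i j m : ℕ) → List (Config m)
  excited f       i j zero    = [] ∷ []
  excited zero    i j (suc m) = []
  excited (suc f) i j (suc m) with suc j ≤? R i
  ... | yes _ = map ((suc i , suc j) ∷_) (excited f i (suc j) m) ++ excited f (suc i) (suc j) (suc m)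
  ... | no  _ = []

  wt : ∀ {m} → Config m → ℚ
  wt v = ℕtoℚ (weight λ′ v)

  open Factorial (ℕtoℚ ∘ γ) ℕtoℚ

  sum-cons : ∀ {m} c (L : List (Config m)) →
    sumℚ (map wt (map (c ∷_) L)) ≡ ℕtoℚ (hook λ′ c) * sumℚ (map wt L)
  sum-cons c []      = sym (ℚₚ.*-zeroʳ (ℕtoℚ (hook λ′ c)))
  sum-cons c (v ∷ L) = trans
    (cong₂ _+_ (ℕtoℚ-* (hook λ′ c) (weight λ′ v)) (sum-cons c L))
    (sym (ℚₚ.*-distribˡ-+ (ℕtoℚ (hook λ′ c)) (wt v) (sumℚ (map wt L))))

  F-outside : ∀ t i j m → R i ≤ j → F t (R i) j (suc m) ≡ 0ℚ
  F-outside t i j m r≤j = F-vanish t (R i) j (suc m) (subst (_< suc m) (sym (ℕ.m≤n⇒m∸n≡0 r≤j)) (s≤s z≤n))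

  -- The split by the leftmost pebble matches `F-recurrence` at t = ρ_i: γ_j - ρ_i is the hook
  -- length of the resting pebble, and cancelling the columns that end in row `i` turns the other
  -- term into the one for row `i + 1`.
  excited-sum : ∀ f i j m → R 0 ≤ f ℕ.+ j → sumℚ (map wt (excited f i j m)) ≡ F (ρ i) (R i) j m
  excited-sum f       i j zero    _   = sym (F-zero (ρ i) (R i) j)
  -- Without fuel the bound puts `j` beyond the first row, hence beyond row `i`.
  excited-sum zero    i j (suc m) r≤j = sym (F-outside (ρ i) i j m (ℕ.≤-trans (row≤first links i) r≤j))
  excited-sum (suc f) i j (suc m) r≤ with suc j ≤? R i
  ... | no  j≮r = sym (F-outside (ρ i) i j m (ℕ.≮⇒≥ j≮r))
  ... | yes j<r = begin
    sumℚ (map wt (map (c ∷_) L₁ ++ L₂))                        ≡⟨ cong sumℚ (map-++ wt (map (c ∷_) L₁) L₂) ⟩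
    sumℚ (map wt (map (c ∷_) L₁) ++ map wt L₂)                 ≡⟨ sumℚ-++ (map wt (map (c ∷_) L₁)) (map wt L₂) ⟩
    sumℚ (map wt (map (c ∷_) L₁)) + sumℚ (map wt L₂)           ≡⟨ cong₂ _+_ (sum-cons c L₁) (excited-sum f (suc i) (suc j) (suc m) bound) ⟩
    ℕtoℚ (hook λ′ c) * sumℚ (map wt L₁) + F (ρ (suc i)) (R (suc i)) (suc j) (suc m)
      ≡⟨ cong₂ (λ x y → x * y + F (ρ (suc i)) (R (suc i)) (suc j) (suc m)) hook≡ (excited-sum f i (suc j) m bound) ⟩
    (ℕtoℚ (γ j) - ℕtoℚ (ρ i)) * F (ρ i) (R i) (suc j) m + F (ρ (suc i)) (R (suc i)) (suc j) (suc m)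
      ≡⟨ cong ((ℕtoℚ (γ j) - ℕtoℚ (ρ i)) * F (ρ i) (R i) (suc j) m +_) next-row ⟨
    (ℕtoℚ (γ j) - ℕtoℚ (ρ i)) * F (ρ i) (R i) (suc j) m + F (suc (ρ i)) (R i) (suc j) (suc m)
      ≡⟨ F-recurrence (ρ i) (R i) j m j<r ⟨
    F (ρ i) (R i) j (suc m) ∎
    where
    c = (suc i , suc j)
    L₁ = excited f i (suc j) m
    L₂ = excited f (suc i) (suc j) (suc m)
    bound : R 0 ≤ f ℕ.+ suc j
    bound = subst (R 0 ≤_) (sym (ℕ.+-suc f j)) r≤
    cancel : ∀ x y → x ≡ (x + y) - y
    cancel = solve-∀ ℚring
    hook≡ : ℕtoℚ (hook λ′ c) ≡ ℕtoℚ (γ j) - ℕtoℚ (ρ i)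
    hook≡ = trans (cancel (ℕtoℚ (hook λ′ c)) (ℕtoℚ (ρ i)))
      (cong (_- ℕtoℚ (ρ i)) (trans (sym (ℕtoℚ-+ (hook λ′ c) (ρ i))) (cong ℕtoℚ (hook-difference i j j<r))))
    q = R i ∸ R (suc i)
    next-row : F (suc (ρ i)) (R i) (suc j) (suc m) ≡ F (ρ (suc i)) (R (suc i)) (suc j) (suc m)
    next-row = begin
      F (suc (ρ i)) (R i) (suc j) (suc m)
        ≡⟨ cong (λ K → F (suc (ρ i)) K (suc j) (suc m)) (ℕ.m+[n∸m]≡n (row-antitone links i)) ⟨
      F (suc (ρ i)) (R (suc i) ℕ.+ q) (suc j) (suc m)
        ≡⟨ F-cancels q (suc (ρ i)) (R (suc i)) (suc j) (suc m) (λ x x<q → cong ℕtoℚ (γ-between-rows i x x<q)) ⟩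
      F (suc (ρ i) ℕ.+ q) (R (suc i)) (suc j) (suc m)
        ≡⟨ cong (λ t → F t (R (suc i)) (suc j) (suc m)) (ρ-suc i) ⟩
      F (ρ (suc i)) (R (suc i)) (suc j) (suc m) ∎

  -- Weakly increasing displacements, read from the left: `stay` fixes the leftmost pebble at its
  -- current start, `shift` moves the starts of all remaining pebbles one diagonal step down. As
  -- `shift` asks for a pebble, the empty configuration arises from `nil` alone.
  data Valid : ℕ → ℕ → ∀ {m} → Config m → Set where
    nil   : ∀ {i j} → Valid i j []
    stay  : ∀ {i j m} {v : Config m} → suc j ≤ R i → Valid i (suc j) v → Valid i j ((suc i , suc j) ∷ v)
    shift : ∀ {i j m} {v : Config (suc m)} → Valid (suc i) (suc j) v → Valid i j v

  -- After a `shift` the starts reach one column further in row `i + 1`, and row `i` is at least as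
  -- long. Hence the starting cells always lie in the diagram.
  Valid-row : ∀ {i j m} {v : Config (suc m)} → Valid i j v → j ℕ.+ suc m ≤ R i
  Valid-row {i} {j} (stay {m = zero}  j<r V) = subst (_≤ R i) (ℕ.+-comm 1 j) j<r
  Valid-row {i} {j} (stay {m = suc m} j<r V) = subst (_≤ R i) (sym (ℕ.+-suc j (suc m))) (Valid-row V)
  Valid-row {i}     (shift V)                  =
    ℕ.≤-trans (ℕ.n≤1+n _) (ℕ.≤-trans (Valid-row V) (row-antitone links i))

  Valid-column : ∀ {i j m} {v : Config (suc m)} → Valid i j v → suc j ≤ R i
  Valid-column {j = j} V = ℕ.≤-trans (ℕ.≤-trans (ℕ.≤-reflexive (ℕ.+-comm 1 j)) (ℕ.+-monoʳ-≤ j (s≤s z≤n))) (Valid-row V)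

  Valid-bounds : ∀ {i j m a b} {v : Config m} → Valid i j v → (a , b) ∈ v → i < a × j < b
  Valid-bounds (stay _ V) (here refl) = ℕ.≤-refl , ℕ.≤-refl
  Valid-bounds (stay _ V) (there c∈v) with Valid-bounds V c∈v
  ... | i<a , j<b = i<a , ℕ.<⇒≤ j<b
  Valid-bounds (shift V)  c∈v         with Valid-bounds V c∈v
  ... | i<a , j<b = ℕ.<⇒≤ i<a , ℕ.<⇒≤ j<b

  Valid-diagonals : ∀ {i j m} {v : Config m} → Valid i j v → OnDiagonals i j v
  Valid-diagonals             nil        = tt
  Valid-diagonals {i} {j}     (stay _ V) = sym (ℕ.+-suc i j) , Valid-diagonals V
  Valid-diagonals {v = v}     (shift V)  = OnDiagonals-shift v (Valid-diagonals V)

  Valid-SameSet : ∀ {i j m} {v w : Config m} → Valid i j v → Valid i j w → SameSet v w → v ≡ w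
  Valid-SameSet {v = v} {w} V W = SameSet⇒≡ v w (Valid-diagonals V) (Valid-diagonals W)

  excited-sound : ∀ f i j m {v} → v ∈ₗ excited f i j m → Valid i j v
  excited-sound f       i j zero    {[]} _ = nil
  excited-sound (suc f) i j (suc m) v∈ with suc j ≤? R i
  ... | yes j<r with ∈-++⁻ (map ((suc i , suc j) ∷_) (excited f i (suc j) m)) v∈
  ...   | inj₂ v∈₂ = shift (excited-sound f (suc i) (suc j) (suc m) v∈₂)
  ...   | inj₁ v∈₁ with ∈-map⁻ _ v∈₁
  ...     | _ , w∈ , refl = stay j<r (excited-sound f i (suc j) m w∈)

  excited-complete : ∀ f i j m {v} → R 0 ≤ f ℕ.+ j → Valid i j v → v ∈ₗ excited f i j m
  excited-complete f       i j zero    {[]} _   _ = LAny.here refl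
  excited-complete zero    i j (suc m) r≤j V =
    contradiction (ℕ.≤-trans (Valid-column V) (ℕ.≤-trans (row≤first links i) r≤j)) ℕ.1+n≰n
  excited-complete (suc f) i j (suc m) r≤ V with suc j ≤? R i
  ... | no j≮r = contradiction (Valid-column V) j≮r
  ... | yes _ with V
  ...   | stay _ W = ∈-++⁺ˡ (∈-map⁺ _ (excited-complete f i (suc j) m (subst (R 0 ≤_) (sym (ℕ.+-suc f j)) r≤) W))
  ...   | shift W  = ∈-++⁺ʳ _ (excited-complete f (suc i) (suc j) (suc m) (subst (R 0 ≤_) (sym (ℕ.+-suc f j)) r≤) W)

  excited-unique : ∀ f i j m → Unique (excited f i j m)
  excited-unique f       i j zero    = [] ∷ []
  excited-unique zero    i j (suc m) = []
  excited-unique (suc f) i j (suc m) with suc j ≤? R i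
  ... | no  _ = []
  ... | yes _ = Unique.++⁺ (Unique.map⁺ (λ { refl → refl }) (excited-unique f i (suc j) m))
                           (excited-unique f (suc i) (suc j) (suc m)) disjoint
    where
    -- In the first list the leftmost pebble is in row `i`; in the second every pebble is below that
    -- row.
    disjoint : ∀ {v} → ¬ (v ∈ₗ map ((suc i , suc j) ∷_) (excited f i (suc j) m)
                          × v ∈ₗ excited f (suc i) (suc j) (suc m))
    disjoint (v∈₁ , v∈₂) with ∈-map⁻ _ v∈₁
    ... | _ , _ , refl = ℕ.1+n≰n (proj₁ (Valid-bounds (excited-sound f (suc i) (suc j) (suc m) v∈₂) (here refl)))

  -- Valid configurations and reachability.

  start : ℕ → ℕ → (m : ℕ) → Config m
  start i j zero    = []
  start i j (suc m) = (suc i , suc j) ∷ start i (suc j) m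

  start-Valid : ∀ i j m → j ℕ.+ m ≤ R i → Valid i j (start i j m)
  start-Valid i j zero    _  = nil
  start-Valid i j (suc m) le rewrite ℕ.+-suc j m =
    stay (ℕ.≤-trans (s≤s (ℕ.m≤m+n j m)) le) (start-Valid i (suc j) m le)

  initial≡start : ∀ m → initial m ≡ start 0 0 m
  initial≡start m = go 0 m
    where
    go : ∀ j m → tabulate {n = m} (λ p → (1 , suc (j ℕ.+ toℕ p))) ≡ start 0 j m
    go j zero    = refl
    go j (suc m) = cong₂ (λ x v → (1 , suc x) ∷ v) (ℕ.+-identityʳ j)
      (trans (tabulate-cong (λ p → cong (λ x → (1 , suc x)) (ℕ.+-suc j (toℕ p)))) (go (suc j) m))

  -- When a leftmost resting pebble moves, its right neighbour is free, so the next pebble, if any,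
  -- has left its start. The remaining pebbles then form a `shift`, which is what the lowered start
  -- requires.
  move-Valid : ∀ {i j m} {v : Config m} → Valid i j v → (p : Fin m) →
    ¬ ((proj₁ (lookup v p) , suc (proj₂ (lookup v p))) ∈ v) →
    InDiagram λ′ (suc (proj₁ (lookup v p)) , suc (proj₂ (lookup v p))) →
    Valid i j (v [ p ]≔ (suc (proj₁ (lookup v p)) , suc (proj₂ (lookup v p))))
  move-Valid {i} {j} (stay {v = v} _ V) zero right∉ (_ , _ , j<r) = shift (stay j<r (lower V right∉))
    where
    lower : ∀ {m} {v : Config m} → Valid i (suc j) v → ¬ ((suc i , suc (suc j)) ∈ (suc i , suc j) ∷ v) →
      Valid (suc i) (suc (suc j)) v
    lower nil        _      = nil
    lower (stay _ _) right∉ = contradiction (there (here refl)) right∉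
    lower (shift V)  _      = V
  move-Valid (stay j<r V) (suc p) right∉ inside = stay j<r (move-Valid V p (right∉ ∘ there) inside)
  move-Valid (shift V)    p       right∉ inside = shift (move-Valid V p right∉ inside)

  Step-Valid : ∀ {i j m} {v w : Config m} → Valid i j v → Step λ′ v w → Valid i j w
  Step-Valid V (p , right∉ , _ , _ , inside , refl) = move-Valid V p right∉ inside

  Star-Valid : ∀ {i j m} {v w : Config m} → Valid i j v → Star (Step λ′) v w → Valid i j w
  Star-Valid V ε        = V
  Star-Valid V (s ◅ ss) = Star-Valid (Step-Valid V s) ss

  -- The cells that the move needs free lie below or to the right of the added pebble.
  Step-cons : ∀ {i j m} {v w : Config m} → Valid i (suc j) v → Step λ′ v w →
    Step λ′ ((suc i , suc j) ∷ v) ((suc i , suc j) ∷ w)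
  Step-cons {i} {j} {v = v} V (p , n₁ , n₂ , n₃ , inside , refl) =
    suc p , avoid₁ , avoid₂ , avoid₃ , inside , refl
    where
    a = proj₁ (lookup v p)
    b = proj₂ (lookup v p)
    i<a : i < a
    i<a = proj₁ (Valid-bounds V (∈-lookup p v))
    j<b : suc j < b
    j<b = proj₂ (Valid-bounds V (∈-lookup p v))
    avoid₁ : ¬ ((a , suc b) ∈ (suc i , suc j) ∷ v)
    avoid₁ (here eq)  = ℕ.<-irrefl (sym (ℕ.suc-injective (cong proj₂ eq))) (ℕ.<⇒≤ j<b)
    avoid₁ (there c∈) = n₁ c∈
    avoid₂ : ¬ ((suc a , b) ∈ (suc i , suc j) ∷ v)
    avoid₂ (here eq)  = ℕ.<-irrefl (sym (ℕ.suc-injective (cong proj₁ eq))) i<a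
    avoid₂ (there c∈) = n₂ c∈
    avoid₃ : ¬ ((suc a , suc b) ∈ (suc i , suc j) ∷ v)
    avoid₃ (here eq)  = ℕ.<-irrefl (sym (ℕ.suc-injective (cong proj₁ eq))) i<a
    avoid₃ (there c∈) = n₃ c∈

  Star-cons : ∀ {i j m} {v w : Config m} → Valid i (suc j) v → Star (Step λ′) v w →
    Star (Step λ′) ((suc i , suc j) ∷ v) ((suc i , suc j) ∷ w)
  Star-cons V ε        = ε
  Star-cons V (s ◅ ss) = Step-cons V s ◅ Star-cons (Step-Valid V s) ss

  -- The pebbles move once each, the rightmost first, so that each finds its right neighbour gone.
  slide : ∀ i j m → suc j ℕ.+ m ≤ R (suc i) → Star (Step λ′) (start i j m) (start (suc i) (suc j) m)
  slide i j zero    _  = ε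
  slide i j (suc m) le =
    Star-cons (start-Valid i (suc j) m (ℕ.≤-trans (ℕ.n≤1+n _) (ℕ.≤-trans le′ (row-antitone links i))))
      (slide i (suc j) m le′)
    ◅◅ (zero , avoid₁ , avoid₂ , avoid₃ , (s≤s z≤n , s≤s z≤n , ℕ.≤-trans (s≤s (s≤s (ℕ.m≤m+n j m))) le′) , refl)
    ◅ ε
    where
    le′ : suc (suc j) ℕ.+ m ≤ R (suc i)
    le′ = subst (_≤ R (suc i)) (cong suc (ℕ.+-suc j m)) le
    rest = start (suc i) (suc (suc j)) m
    beyond : ∀ {a b} → (a , b) ∈ rest → suc (suc j) < b
    beyond = proj₂ ∘ Valid-bounds (start-Valid (suc i) (suc (suc j)) m le′)
    avoid₁ : ¬ ((suc i , suc (suc j)) ∈ (suc i , suc j) ∷ rest)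
    avoid₁ (there c∈) = ℕ.1+n≰n (beyond c∈)
    avoid₂ : ¬ ((suc (suc i) , suc j) ∈ (suc i , suc j) ∷ rest)
    avoid₂ (there c∈) = ℕ.1+n≰n (ℕ.<⇒≤ (beyond c∈))
    avoid₃ : ¬ ((suc (suc i) , suc (suc j)) ∈ (suc i , suc j) ∷ rest)
    avoid₃ (there c∈) = ℕ.1+n≰n (beyond c∈)

  Valid-start : ∀ {i j m} {v : Config m} → Valid i j v → Valid i j (start i j m)
  Valid-start {m = zero}          V = nil
  Valid-start {i} {j} {suc m} V = start-Valid i j (suc m) (Valid-row V)

  -- The derivation is a schedule of moves: `shift` slides all the remaining pebbles, `stay` leaves
  -- the leftmost one behind.
  Valid-Star : ∀ {i j m} {v : Config m} → Valid i j v → Star (Step λ′) (start i j m) v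
  Valid-Star nil        = ε
  Valid-Star (stay _ V) = Star-cons (Valid-start V) (Valid-Star V)
  Valid-Star (shift V)  = slide _ _ _ (Valid-row V) ◅◅ Valid-Star V

  -- Enumerations of the excited diagrams.

  module _ (m : ℕ) (m≤k : m ≤ R 0) where

    Reachable⇒Valid : ∀ {v} → Reachable λ′ m v → Valid 0 0 v
    Reachable⇒Valid {v} r =
      Star-Valid (start-Valid 0 0 m m≤k) (subst (λ u → Star (Step λ′) u v) (initial≡start m) r)

    Valid⇒Reachable : ∀ {v} → Valid 0 0 v → Reachable λ′ m v
    Valid⇒Reachable {v} V = subst (λ u → Star (Step λ′) u v) (sym (initial≡start m)) (Valid-Star V)

    diagrams : List (Config m)
    diagrams = excited (R 0) 0 0 m

    diagrams-sound : ∀ {v} → v ∈ₗ diagrams → Valid 0 0 v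
    diagrams-sound = excited-sound (R 0) 0 0 m

    diagrams-complete : ∀ {v} → Reachable λ′ m v → v ∈ₗ diagrams
    diagrams-complete r = excited-complete (R 0) 0 0 m (ℕ.m≤m+n (R 0) 0) (Reachable⇒Valid r)

    diagrams-Enumerates : Enumerates λ′ m diagrams
    diagrams-Enumerates =
      LAll.map Valid⇒Reachable valid ,
      (λ v r → LAny.map (λ { refl → SameSet-refl }) (diagrams-complete r)) ,
      distinct valid (excited-unique (R 0) 0 0 m)
      where
      valid : All (Valid 0 0) diagrams
      valid = LAll.tabulate diagrams-sound
      distinct : ∀ {L : List (Config m)} → All (Valid 0 0) L → Unique L → AllPairs (λ v w → ¬ SameSet v w) L
      distinct []       []         = []
      distinct (V ∷ Vs) (v∉ ∷ uniq) =
        LAll.zipWith (λ { (W , v≢w) same → v≢w (Valid-SameSet V W same) }) (Vs , v∉) ∷ distinct Vs uniq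

    -- Both lists are free of repetitions and contain exactly the reachable configurations, for
    -- which equality as sets is equality of vectors.
    Enumerates-↭ : ∀ L → Enumerates λ′ m L → L ↭ diagrams
    Enumerates-↭ L (reachable , complete , distinct) =
      ∼bag⇒↭ (unique∧set⇒bag unique (excited-unique (R 0) 0 0 m) (mk⇔ to from))
      where
      unique : Unique L
      unique = AllPairs.map (λ { ¬same refl → ¬same SameSet-refl }) distinct
      to : ∀ {v} → v ∈ₗ L → v ∈ₗ diagrams
      to v∈L = diagrams-complete (LAll.lookup reachable v∈L)
      from : ∀ {v} → v ∈ₗ diagrams → v ∈ₗ L
      from {v} v∈ with find (complete v (Valid⇒Reachable (diagrams-sound v∈)))
      ... | w , w∈L , same = subst (_∈ₗ L) (sym (Valid-SameSet (diagrams-sound v∈)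
        (Reachable⇒Valid (LAll.lookup reachable w∈L)) same)) w∈L

    Enumerates-sum : ∀ L → Enumerates λ′ m L → sumℚ (map wt L) ≡ F 0 (R 0) 0 m
    Enumerates-sum L enum = begin
      sumℚ (map wt L)          ≡⟨ sumℚ-↭ (map⁺ wt (Enumerates-↭ L enum)) ⟩
      sumℚ (map wt diagrams)   ≡⟨ excited-sum (R 0) 0 0 m (ℕ.m≤m+n (R 0) 0) ⟩
      F (ρ 0) (R 0) 0 m        ≡⟨ cong (λ t → F t (R 0) 0 m) (ℕ.n∸n≡0 (R 0)) ⟩
      F 0 (R 0) 0 m            ∎

theorem4p2 : (S : ℕ → Poly) → IsStirling S →
    (n : ℕ) → 1 ≤ n → (λ′ : Partition) → IsPartitionOf n λ′ →
    (m : ℕ) → EIs λ′ m (rhs S λ′ m)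
theorem4p2 S isStirling n _ λ′ (_ , links , _) m =
  (λ m≤k → (diagrams m m≤k , diagrams-Enumerates m m≤k) ,
    λ L enum → trans (Enumerates-sum m m≤k L enum) (sym (rhs-F λ′ m m≤k))) ,
  rhs-vanish λ′ m
  where
  open Diagram λ′ links
  open Stirling S isStirling
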